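{- Two graphs $G$ and $H$ are isomorphic if, and only if, they are homomorphism indistinguishable over the class of all graphs that do not contain the complete graph $K_5$ as a topological minor.
   Context: All graphs are finite, simple, undirected and loopless. $\hom(F,G)$ is the number of homomorphisms $F\to G$. $G,H$ are homomorphism indistinguishable over a class $\mathcal{C}$ if $\hom(F,G)=\hom(F,H)$ for all $F\in\mathcal{C}$. A graph $M$ is a topological minor of $F$ if there is a map $\rho\colon V(M)\to V(F)$ (injective) and a collection of internally vertex-disjoint paths $(P_{vw})_{vw\in E(M)}$ in $F$ with $P_{vw}$ connecting $\rho(v)$ and $\rho(w)$. -}

module Defs where

open import Data.Nat using (ℕ; zero; suc; _+_)
open import Data.Bool using (Bool; true; false; not; _∧_; _∨_; if_then_else_)
open import Data.Fin using (Fin; _<_) renaming (_≟_ to _≟ᶠ_)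
open import Data.List using (List; []; _∷_; _++_; [_]; map; concatMap)
open import Data.Nat.ListAction using (sum)
open import Data.Bool.ListAction using (all)
open import Data.List.Membership.Propositional using (_∈_)
open import Data.List.Relation.Unary.Unique.Propositional using (Unique)
open import Data.List.Relation.Unary.Linked using (Linked)
open import Data.Vec using (Vec; lookup) renaming ([] to []ᵛ; _∷_ to _∷ᵛ_)
open import Data.Product using (Σ; _×_; _,_)
open import Data.List using (allFin)
open import Relation.Binary.PropositionalEquality using (_≡_; refl) renaming (sym to ≡-sym)
open import Relation.Nullary using (¬_; yes; no)
open import Data.Empty using (⊥-elim)
open import Relation.Nullary.Decidable using (⌊_⌋)
open import Function.Bundles using (_↔_; Inverse)

record Graph : Set where
  field
    n      : ℕ
    adj    : Fin n → Fin n → Bool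
    adj-sym : ∀ i j → adj i j ≡ adj j i
    irrefl : ∀ i → adj i i ≡ false
open Graph public

allMaps : (k m : ℕ) → List (Vec (Fin m) k)
allMaps zero    m = []ᵛ ∷ []
allMaps (suc k) m = concatMap (λ x → map (x ∷ᵛ_) (allMaps k m)) (allFin m)

isHom : (F G : Graph) → Vec (Fin (n G)) (n F) → Bool
isHom F G f =
  all (λ i → all (λ j → not (adj F i j) ∨ adj G (lookup f i) (lookup f j))
                 (allFin (n F)))
      (allFin (n F))

hom : Graph → Graph → ℕ
hom F G = sum (map (λ f → if isHom F G f then 1 else 0) (allMaps (n F) (n G)))

HomIndist : (Graph → Set) → Graph → Graph → Set
HomIndist 𝒞 G H = ∀ F → 𝒞 F → hom F G ≡ hom F H

Iso : Graph → Graph → Set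
Iso G H = Σ (Fin (n G) ↔ Fin (n H)) λ f →
  ∀ i j → adj G i j ≡ adj H (Inverse.to f i) (Inverse.to f j)

record TopMinor (M F : Graph) : Set where
  field
    ρ          : Fin (n M) → Fin (n F)
    ρ-inj      : ∀ u v → ρ u ≡ ρ v → u ≡ v
    interior   : (v w : Fin (n M)) → v < w → adj M v w ≡ true → List (Fin (n F))
  path : (v w : Fin (n M)) → v < w → adj M v w ≡ true → List (Fin (n F))
  path v w p e = ρ v ∷ interior v w p e ++ [ ρ w ]
  field
    is-walk    : ∀ v w p e → Linked (λ a b → adj F a b ≡ true) (path v w p e)
    is-path    : ∀ v w p e → Unique (path v w p e)
    avoid-ρ    : ∀ v w p e u → ¬ (ρ u ∈ interior v w p e)
    disjoint   : ∀ v w p e v' w' p' e' → ¬ (v ≡ v' × w ≡ w') →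
                 ∀ x → x ∈ interior v w p e → ¬ (x ∈ interior v' w' p' e')

eqb : ∀ {k} → Fin k → Fin k → Bool
eqb i j = ⌊ i ≟ᶠ j ⌋

private
  eqb-sym : ∀ {k} (i j : Fin k) → eqb i j ≡ eqb j i
  eqb-sym i j with i ≟ᶠ j | j ≟ᶠ i
  ... | yes _ | yes _ = refl
  ... | no _  | no _  = refl
  ... | yes p | no q  = ⊥-elim (q (≡-sym p))
  ... | no p  | yes q = ⊥-elim (p (≡-sym q))

  eqb-refl : ∀ {k} (i : Fin k) → eqb i i ≡ true
  eqb-refl i with i ≟ᶠ i
  ... | yes _ = refl
  ... | no q  = ⊥-elim (q refl)

  not-cong : ∀ {a b} → a ≡ b → not a ≡ not b
  not-cong refl = refl

K : ℕ → Graph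
K k = record
  { n = k
  ; adj = λ i j → not (eqb i j)
  ; adj-sym = λ i j → not-cong (eqb-sym i j)
  ; irrefl = λ i → not-cong (eqb-refl i)
  }

{-# OPTIONS --safe #-}
-- Call vertices with equal neighbourhoods twins; u and v are twins iff codeg u v = codeg u u = codeg v v,
-- where codeg counts common neighbours. Take a "core" graph in which every vertex has at most three
-- neighbours, and add any number of new vertices of degree at most 2 whose neighbours are equal or joined
-- in the core. The branch vertices of a topological K₅ would lie in the core and four paths would leave
-- one of them through at most three core vertices, so the result is K₅-free. Its homomorphism counts are
-- ∑ₓ ∏ codeg (x a) (x b) over the maps x of the core, hence by interpolation they determine how many x have
-- prescribed codegrees along all core edges; in particular twin relations can be prescribed.
--
-- Now simulate each vertex of G by a path of twins, long enough that any two such paths can be joined by an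
-- edge while degrees stay at most 3. Lengthening a path multiplies each count by the size of a twin class,
-- so a second interpolation fixes these sizes too. The copy of G in itself thus yields φ : G → H preserving
-- edges, codegrees and twin class sizes. Rearranging φ inside the twin classes makes it bijective, and as it
-- preserves degrees it is an isomorphism.
module Submission where

open import Defs
open import Relation.Nullary using (¬_; Dec; yes; no; does)
open import Function.Bundles using (_⇔_; _↔_; Inverse; mk⇔; mk↔ₛ′)
open import Relation.Nullary.Decidable using (_×-dec_; _⊎-dec_; _→-dec_; map′; dec-true)
open import Relation.Binary using (tri<; tri≈; tri>)
open import Relation.Binary.PropositionalEquality hiding ([_])
open import Function using (_∘_; id)
open import Data.Nat using (ℕ; zero; suc; z≤n; s≤s)
import Data.Nat as ℕ
import Data.Nat.Properties as ℕ
open import Data.Nat.ListAction using (sum; product)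
open import Data.Nat.ListAction.Properties using (sum-++)
open import Data.Bool using (Bool; true; false; not; _∧_; _∨_; if_then_else_)
import Data.Bool.Properties as B
open import Data.Bool.ListAction using (all)
open import Data.Fin as Fin using (Fin; zero; suc; punchIn; punchOut; inject₁; combine; remQuot)
import Data.Fin.Properties as F
open import Data.Fin.Induction using (<-weakInduction)
open import Data.List as List using (List; []; _∷_; _++_; [_]; map; concatMap; allFin; length; filter; cartesianProduct)
open import Data.List.Properties using (map-cong; map-++; map-∘; map-tabulate; length-map)
open import Data.List.Membership.Propositional using (_∈_)
open import Data.List.Membership.Propositional.Properties
import Data.List.Membership.DecPropositional as DecMembership
open import Data.List.Relation.Unary.Any as Any using (here; there)
open import Data.List.Relation.Unary.Any.Properties using (lookup-index)
open import Data.List.Relation.Unary.All as All using (All; []; _∷_)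
import Data.List.Relation.Unary.All.Properties as All
open import Data.List.Relation.Unary.AllPairs using (_∷_)
open import Data.List.Relation.Unary.Linked using (Linked; _∷_)
open import Data.List.Relation.Unary.Unique.Propositional using (Unique)
open import Data.Vec using (Vec; lookup; tabulate) renaming ([] to []ᵛ; _∷_ to _∷ᵛ_; map to mapᵛ)
open import Data.Vec.Properties using (lookup∘tabulate; lookup-map)
open import Data.Product using (_×_; _,_; proj₁; proj₂; ∃; uncurry)
open import Data.Sum using (_⊎_; inj₁; inj₂)
open import Data.Empty using (⊥-elim)
open import Data.Unit using (⊤; tt)

-- Finite sums, products and 0/1 indicators.

module FiniteSums where

  open import Data.Nat
  open import Data.Nat.Properties
  open import Data.Nat.Tactic.RingSolver using (solve-∀)
  import Algebra.Properties.CommutativeMonoid.Sum +-0-commutativeMonoid as T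

  private variable
    A C : Set
    P Q R : Set

  ∑ : List A → (A → ℕ) → ℕ
  ∑ xs f = sum (map f xs)

  ∏ : List A → (A → ℕ) → ℕ
  ∏ xs f = product (map f xs)

  𝟙 : Dec P → ℕ
  𝟙 d = if does d then 1 else 0

  𝟙-cong : (p? : Dec P) (q? : Dec Q) → (P → Q) → (Q → P) → 𝟙 p? ≡ 𝟙 q?
  𝟙-cong (yes p) (yes q) _ _ = refl
  𝟙-cong (no ¬p) (no ¬q) _ _ = refl
  𝟙-cong (yes p) (no ¬q) f _ = ⊥-elim (¬q (f p))
  𝟙-cong (no ¬p) (yes q) _ g = ⊥-elim (¬p (g q))

  𝟙-× : (p? : Dec P) (q? : Dec Q) (r? : Dec R) → (R → P × Q) → (P → Q → R) → 𝟙 r? ≡ 𝟙 p? * 𝟙 q?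
  𝟙-× p? q? r? f g = trans (𝟙-cong r? (p? ×-dec q?) f (λ (p , q) → g p q)) (lem p? q?)
    where
    lem : (p? : Dec P) (q? : Dec Q) → 𝟙 (p? ×-dec q?) ≡ 𝟙 p? * 𝟙 q?
    lem (yes _) (yes _) = refl
    lem (yes _) (no _)  = refl
    lem (no _)  _       = refl

  𝟙-yes : (p? : Dec P) → P → 𝟙 p? ≡ 1
  𝟙-yes (yes _) _ = refl
  𝟙-yes (no ¬p) p = ⊥-elim (¬p p)

  𝟙-pos : (p? : Dec P) → 0 < 𝟙 p? → P
  𝟙-pos (yes p) _ = p

  𝟙≤1 : (p? : Dec P) → 𝟙 p? ≤ 1
  𝟙≤1 (yes _) = s≤s z≤n
  𝟙≤1 (no _)  = z≤n

  𝟙-idem : (p? : Dec P) → 𝟙 p? * 𝟙 p? ≡ 𝟙 p?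
  𝟙-idem (yes _) = refl
  𝟙-idem (no _)  = refl

  𝟙-mono : (p? : Dec P) (q? : Dec Q) → (P → Q) → 𝟙 p? ≤ 𝟙 q?
  𝟙-mono (no _)  _       _ = z≤n
  𝟙-mono (yes _) (yes _) _ = s≤s z≤n
  𝟙-mono (yes p) (no ¬q) f = ⊥-elim (¬q (f p))

  𝟙-*-cong : (p? : Dec P) {x y : ℕ} → (P → x ≡ y) → 𝟙 p? * x ≡ 𝟙 p? * y
  𝟙-*-cong (yes p) e = cong (1 *_) (e p)
  𝟙-*-cong (no _)  _ = refl

  ∑-cong : (xs : List A) {f g : A → ℕ} → (∀ x → f x ≡ g x) → ∑ xs f ≡ ∑ xs g
  ∑-cong xs e = cong sum (map-cong e xs)

  ∑-zero : (xs : List A) → ∑ xs (λ _ → 0) ≡ 0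
  ∑-zero []       = refl
  ∑-zero (x ∷ xs) = ∑-zero xs

  ∑-+ : (xs : List A) (f g : A → ℕ) → ∑ xs (λ x → f x + g x) ≡ ∑ xs f + ∑ xs g
  ∑-+ []       f g = refl
  ∑-+ (x ∷ xs) f g = trans (cong (f x + g x +_) (∑-+ xs f g)) (lem (f x) (g x) (∑ xs f) (∑ xs g))
    where
    lem : ∀ a b c d → a + b + (c + d) ≡ a + c + (b + d)
    lem = solve-∀

  ∑-*ˡ : (xs : List A) (c : ℕ) (f : A → ℕ) → ∑ xs (λ x → c * f x) ≡ c * ∑ xs f
  ∑-*ˡ []       c f = sym (*-zeroʳ c)
  ∑-*ˡ (x ∷ xs) c f = trans (cong (c * f x +_) (∑-*ˡ xs c f)) (sym (*-distribˡ-+ c (f x) (∑ xs f)))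

  ∑-swap : (xs : List A) (ys : List C) (f : A → C → ℕ) →
           ∑ xs (λ x → ∑ ys (f x)) ≡ ∑ ys (λ y → ∑ xs (λ x → f x y))
  ∑-swap []       ys f = sym (∑-zero ys)
  ∑-swap (x ∷ xs) ys f = trans (cong (∑ ys (f x) +_) (∑-swap xs ys f)) (sym (∑-+ ys (f x) _))

  ∑-++ : (xs ys : List A) (f : A → ℕ) → ∑ (xs ++ ys) f ≡ ∑ xs f + ∑ ys f
  ∑-++ xs ys f = trans (cong sum (map-++ f xs ys)) (sum-++ (map f xs) (map f ys))

  ∑-concatMap : (xs : List A) (h : A → List C) (f : C → ℕ) → ∑ (concatMap h xs) f ≡ ∑ xs (λ x → ∑ (h x) f)
  ∑-concatMap []       h f = refl
  ∑-concatMap (x ∷ xs) h f = trans (∑-++ (h x) (concatMap h xs) f) (cong (∑ (h x) f +_) (∑-concatMap xs h f))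

  -- Added vertices always become vertex `zero`; with its image summed innermost, it can be summed
  -- out while the rest of the map is fixed.
  ∑-allMaps : ∀ k m (f : Vec (Fin m) (suc k) → ℕ) →
              ∑ (allMaps (suc k) m) f ≡ ∑ (allMaps k m) (λ x → ∑ (allFin m) (λ a → f (a ∷ᵛ x)))
  ∑-allMaps k m f = trans (∑-concatMap (allFin m) _ f)
    (trans (∑-cong (allFin m) (λ a → cong sum (sym (map-∘ (allMaps k m)))))
           (∑-swap (allFin m) (allMaps k m) _))

  ∑-mono : (xs : List A) {f g : A → ℕ} → (∀ x → f x ≤ g x) → ∑ xs f ≤ ∑ xs g
  ∑-mono []       h = z≤n
  ∑-mono (x ∷ xs) h = +-mono-≤ (h x) (∑-mono xs h)

  -- Slack at one entry could not be made up at another. This turns equal totals into pointwise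
  -- facts: inclusion of neighbourhoods for codegrees, reflection of edges for `ψ`.
  ∑-≤-tight : (xs : List A) {f g : A → ℕ} → (∀ x → f x ≤ g x) → ∑ xs f ≡ ∑ xs g → ∀ {x} → x ∈ xs → f x ≡ g x
  ∑-≤-tight (x ∷ xs) {f} {g} h e (here refl) = ≤-antisym (h x)
    (+-cancelʳ-≤ (∑ xs g) (g x) (f x) (≤-trans (≤-reflexive (sym e)) (+-monoʳ-≤ (f x) (∑-mono xs h))))
  ∑-≤-tight (x ∷ xs) {f} {g} h e (there x∈) = ∑-≤-tight xs h
    (≤-antisym (∑-mono xs h) (+-cancelˡ-≤ (g x) _ _ (≤-trans (≤-reflexive (sym e)) (+-monoˡ-≤ (∑ xs f) (h x))))) x∈

  ∑-pos : (xs : List A) (f : A → ℕ) → ∀ {x} → x ∈ xs → 0 < f x → 0 < ∑ xs f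
  ∑-pos (x ∷ xs) f (here refl) p = ≤-trans p (m≤m+n _ _)
  ∑-pos (x ∷ xs) f (there x∈)  p = ≤-trans (∑-pos xs f x∈ p) (m≤n+m _ _)

  ∑-pos⁻¹ : (xs : List A) (f : A → ℕ) → 0 < ∑ xs f → ∃ λ x → 0 < f x
  ∑-pos⁻¹ (x ∷ xs) f p with f x in e
  ... | zero  = ∑-pos⁻¹ xs f p
  ... | suc _ = x , subst (0 <_) (sym e) (s≤s z≤n)

  ∑-const-1 : ∀ m → ∑ (allFin m) (λ _ → 1) ≡ m
  ∑-const-1 m = trans (cong sum (map-tabulate {n = m} id (λ _ → 1))) (go m)
    where
    go : ∀ m → sum (List.tabulate {n = m} (λ _ → 1)) ≡ m
    go zero    = refl
    go (suc m) = cong suc (go m)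

  ∑-allFin≤ : ∀ m (f : Fin m → ℕ) → (∀ x → f x ≤ 1) → ∑ (allFin m) f ≤ m
  ∑-allFin≤ m f h = ≤-trans (∑-mono (allFin m) h) (≤-reflexive (∑-const-1 m))

  ∑-allFin : ∀ m (f : Fin m → ℕ) → ∑ (allFin m) f ≡ T.sum f
  ∑-allFin m f = trans (cong sum (map-tabulate id f)) (go m f)
    where
    go : ∀ m (f : Fin m → ℕ) → sum (List.tabulate f) ≡ T.sum f
    go zero    f = refl
    go (suc m) f = cong (f zero +_) (go m (f ∘ suc))

  ∑-reindex : ∀ {m n} (π : Fin m ↔ Fin n) (f : Fin n → ℕ) →
              ∑ (allFin n) f ≡ ∑ (allFin m) (f ∘ Inverse.to π)
  ∑-reindex {m} {n} π f = trans (∑-allFin n f) (trans (T.sum-permute f π) (sym (∑-allFin m (f ∘ Inverse.to π))))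

  ∈-allMaps : ∀ {k m} (x : Vec (Fin m) k) → x ∈ allMaps k m
  ∈-allMaps []ᵛ = here refl
  ∈-allMaps (a ∷ᵛ x) = ∈-concatMap⁺ (λ a → map (a ∷ᵛ_) (allMaps _ _))
    (Any.map (λ { refl → ∈-map⁺ (a ∷ᵛ_) (∈-allMaps x) }) (∈-allFin a))

open FiniteSums

-- Lagrange interpolation: from product moments to counts of prescribed values.

module Interpolation where

  open import Data.Integer hiding (suc)
  open import Data.Integer.Properties
  open import Data.Integer.Tactic.RingSolver using (solve-∀)

  ∑ᶻ : {A : Set} → List A → (A → ℤ) → ℤ
  ∑ᶻ []       f = 0ℤ
  ∑ᶻ (x ∷ xs) f = f x + ∑ᶻ xs f

  module _ {A : Set} where

    ∑ᶻ-cong : (xs : List A) {f g : A → ℤ} → (∀ x → f x ≡ g x) → ∑ᶻ xs f ≡ ∑ᶻ xs g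
    ∑ᶻ-cong []       e = refl
    ∑ᶻ-cong (x ∷ xs) e = cong₂ _+_ (e x) (∑ᶻ-cong xs e)

    ∑ᶻ-linear : (xs : List A) (c : ℤ) (f g : A → ℤ) →
                ∑ᶻ xs (λ x → f x + c * g x) ≡ ∑ᶻ xs f + c * ∑ᶻ xs g
    ∑ᶻ-linear []       c f g = sym (trans (+-identityˡ _) (*-zeroʳ c))
    ∑ᶻ-linear (x ∷ xs) c f g = trans (cong (_+_ (f x + c * g x)) (∑ᶻ-linear xs c f g))
                                     (lem (f x) c (g x) (∑ᶻ xs f) (∑ᶻ xs g))
      where
      lem : ∀ a c b s t → a + c * b + (s + c * t) ≡ a + s + c * (b + t)
      lem = solve-∀

    ∑ᶻ-*ˡ : (xs : List A) (c : ℤ) (f : A → ℤ) → ∑ᶻ xs (λ x → c * f x) ≡ c * ∑ᶻ xs f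
    ∑ᶻ-*ˡ []       c f = sym (*-zeroʳ c)
    ∑ᶻ-*ˡ (x ∷ xs) c f = trans (cong (_+_ (c * f x)) (∑ᶻ-*ˡ xs c f)) (sym (*-distribˡ-+ c (f x) _))

    ∑ᶻ-pos : (xs : List A) (f : A → ℕ) → ∑ᶻ xs (λ x → + f x) ≡ + ∑ xs f
    ∑ᶻ-pos []       f = refl
    ∑ᶻ-pos (x ∷ xs) f = trans (cong (_+_ (+ f x)) (∑ᶻ-pos xs f)) (sym (pos-+ (f x) _))

  -- The unnormalised Lagrange polynomial at v for the nodes below M.
  lagrange : ℕ → ℕ → ℕ → ℤ
  lagrange v zero    t = 1ℤ
  lagrange v (suc M) t with M ℕ.≟ v
  ... | yes _ = lagrange v M t
  ... | no  _ = lagrange v M t * (+ t - + M)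

  lagrange-≢ : ∀ v M {t} → t ℕ.< M → t ≢ v → lagrange v M t ≡ 0ℤ
  lagrange-≢ v (suc M) {t} t<M t≢v with M ℕ.≟ v | ℕ.m≤n⇒m<n∨m≡n (ℕ.s≤s⁻¹ t<M)
  ... | yes M≡v | inj₁ t<M′ = lagrange-≢ v M t<M′ t≢v
  ... | yes M≡v | inj₂ refl = ⊥-elim (t≢v M≡v)
  ... | no _    | inj₁ t<M′ = trans (cong (_* (+ t - + M)) (lagrange-≢ v M t<M′ t≢v)) (*-zeroˡ (+ t - + M))
  ... | no _    | inj₂ refl = trans (cong (lagrange v M t *_) (+-inverseʳ (+ t))) (*-zeroʳ (lagrange v M t))

  lagrange-nonzero : ∀ v M → lagrange v M v ≢ 0ℤ
  lagrange-nonzero v zero    ()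
  lagrange-nonzero v (suc M) e with M ℕ.≟ v
  ... | yes _   = lagrange-nonzero v M e
  ... | no M≢v with i*j≡0⇒i≡0∨j≡0 (lagrange v M v) e
  ...   | inj₁ e′ = lagrange-nonzero v M e′
  ...   | inj₂ e′ = M≢v (sym (+-injective (i-j≡0⇒i≡j (+ v) (+ M) e′)))

  -- Division-free interpolation: the value at `v` stays as a nonzero factor, to be cancelled later.
  lagrange-𝟙 : ∀ v M {t} → t ℕ.< M → lagrange v M t ≡ lagrange v M v * + 𝟙 (t ℕ.≟ v)
  lagrange-𝟙 v M {t} t<M = go (t ℕ.≟ v)
    where
    go : (d : Dec (t ≡ v)) → lagrange v M t ≡ lagrange v M v * + 𝟙 d
    go (yes refl) = sym (*-identityʳ _)
    go (no t≢v)   = trans (lagrange-≢ v M t<M t≢v) (sym (*-zeroʳ (lagrange v M v)))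

  -- Common setting of both interpolations: `f` and `g` are bounded statistics with indices in `I`,
  -- and `P` selects the indices whose products are known to have equal sums.
  module Moments {A B I : Set} (P : I → Set) (xs : List A) (ys : List B)
    (f : A → I → ℕ) (g : B → I → ℕ) (M : ℕ) (f<M : ∀ x c → f x c ℕ.< M) (g<M : ∀ y c → g y c ℕ.< M) where

    -- A record, so that the weights can be inferred from its type. They are signed because the
    -- factors of a Lagrange polynomial can be negative.
    record Balanced (u : A → ℤ) (u′ : B → ℤ) : Set where
      constructor balanced
      field
        moments : ∀ ps → All P ps →
          ∑ᶻ xs (λ x → u x * + ∏ ps (f x)) ≡ ∑ᶻ ys (λ y → u′ y * + ∏ ps (g y))
    open Balanced

    balanced-cong : ∀ {u u′ w w′} → (∀ x → u x ≡ w x) → (∀ y → u′ y ≡ w′ y) → Balanced u u′ → Balanced w w′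
    balanced-cong e e′ bal .moments ps pps = trans
      (∑ᶻ-cong xs (λ x → cong (_* + ∏ ps (f x)) (sym (e x))))
      (trans (bal .moments ps pps) (∑ᶻ-cong ys (λ y → cong (_* + ∏ ps (g y)) (e′ y))))

    -- A factor `f x c` turns the moment of `ps` into that of `c ∷ ps`, and subtracting `k` times
    -- the moment of `ps` preserves the balance.
    balanced-shift : ∀ {u u′} → Balanced u u′ → ∀ {c} → P c → ∀ k →
                     Balanced (λ x → u x * (+ f x c - + k)) (λ y → u′ y * (+ g y c - + k))
    balanced-shift {u} {u′} bal {c} pc k .moments ps pps =
      trans (half xs u f)
      (trans (cong₂ (λ a b → a + - + k * b) (bal .moments (c ∷ ps) (pc ∷ pps)) (bal .moments ps pps))
      (sym (half ys u′ g)))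
      where
      alg : ∀ a b c d → a * (b - c) * d ≡ a * (b * d) + - c * (a * d)
      alg = solve-∀
      half : ∀ {C : Set} (zs : List C) (w : C → ℤ) (h : C → I → ℕ) →
        ∑ᶻ zs (λ x → w x * (+ h x c - + k) * + ∏ ps (h x)) ≡
        ∑ᶻ zs (λ x → w x * + ∏ (c ∷ ps) (h x)) + - + k * ∑ᶻ zs (λ x → w x * + ∏ ps (h x))
      half zs w h = trans
        (∑ᶻ-cong zs (λ x → trans (alg (w x) (+ h x c) (+ k) (+ ∏ ps (h x)))
          (cong (λ e → w x * e + - + k * (w x * + ∏ ps (h x))) (sym (pos-* (h x c) (∏ ps (h x)))))))
        (∑ᶻ-linear zs (- + k) _ _)

    balanced-lagrange : ∀ {u u′} → Balanced u u′ → ∀ {c} → P c → ∀ v N →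
                      Balanced (λ x → u x * lagrange v N (f x c)) (λ y → u′ y * lagrange v N (g y c))
    balanced-lagrange {u} {u′} bal pc v zero =
      balanced-cong (λ x → sym (*-identityʳ (u x))) (λ y → sym (*-identityʳ (u′ y))) bal
    balanced-lagrange {u} {u′} bal {c} pc v (suc N) with N ℕ.≟ v
    ... | yes _ = balanced-lagrange bal pc v N
    ... | no _  = balanced-cong
      (λ x → *-assoc (u x) (lagrange v N (f x c)) _) (λ y → *-assoc (u′ y) (lagrange v N (g y c)) _)
      (balanced-shift (balanced-lagrange bal pc v N) pc N)

    -- All values lie below `M`, so weighting by the Lagrange polynomial is weighting by the
    -- indicator times the nonzero integer `D`, which cancels.
    balanced-𝟙 : ∀ {u u′} → Balanced u u′ → ∀ {c} → P c → ∀ v →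
                 Balanced (λ x → u x * + 𝟙 (f x c ℕ.≟ v)) (λ y → u′ y * + 𝟙 (g y c ℕ.≟ v))
    balanced-𝟙 {u} {u′} bal {c} pc v .moments ps pps =
      *-cancelˡ-≡ D _ _ ⦃ ≢-nonZero (lagrange-nonzero v M) ⦄
        (trans (sym (half xs u f (λ x → f<M x c)))
        (trans (balanced-lagrange bal pc v M .moments ps pps) (half ys u′ g (λ y → g<M y c))))
      where
      D = lagrange v M v
      alg : ∀ a d i b → a * (d * i) * b ≡ d * (a * i * b)
      alg = solve-∀
      half : ∀ {C : Set} (zs : List C) (w : C → ℤ) (h : C → I → ℕ) → (∀ x → h x c ℕ.< M) →
        ∑ᶻ zs (λ x → w x * lagrange v M (h x c) * + ∏ ps (h x)) ≡
        D * ∑ᶻ zs (λ x → w x * + 𝟙 (h x c ℕ.≟ v) * + ∏ ps (h x))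
      half zs w h h<M = trans
        (∑ᶻ-cong zs (λ x → trans (cong (λ e → w x * e * + ∏ ps (h x)) (lagrange-𝟙 v M (h<M x)))
          (alg (w x) D (+ 𝟙 (h x c ℕ.≟ v)) (+ ∏ ps (h x)))))
        (∑ᶻ-*ˡ zs D _)

    module _ (v : I → ℕ) where

      matches? : ∀ {C : Set} (h : C → I → ℕ) cs x → Dec (All (λ c → h x c ≡ v c) cs)
      matches? h cs x = All.all? (λ c → h x c ℕ.≟ v c) cs

      balanced-matches : ∀ cs {u u′} → Balanced u u′ → All P cs →
        Balanced (λ x → u x * + 𝟙 (matches? f cs x)) (λ y → u′ y * + 𝟙 (matches? g cs y))
      balanced-matches [] {u} {u′} bal [] =
        balanced-cong (λ x → sym (*-identityʳ (u x))) (λ y → sym (*-identityʳ (u′ y))) bal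
      balanced-matches (c ∷ cs) {u} {u′} bal (pc ∷ pcs) =
        balanced-cong (step f u) (step g u′) (balanced-matches cs (balanced-𝟙 bal pc (v c)) pcs)
        where
        step : ∀ {C : Set} (h : C → I → ℕ) (w : C → ℤ) x →
          w x * + 𝟙 (h x c ℕ.≟ v c) * + 𝟙 (matches? h cs x) ≡ w x * + 𝟙 (matches? h (c ∷ cs) x)
        step h w x = trans (*-assoc (w x) _ _) (cong (w x *_)
          (trans (sym (pos-* (𝟙 (h x c ℕ.≟ v c)) (𝟙 (matches? h cs x))))
            (cong +_ (sym (𝟙-× (h x c ℕ.≟ v c) (matches? h cs x) (matches? h (c ∷ cs) x)
              (λ { (p ∷ q) → p , q }) _∷_)))))

      -- The conditions in `cs` are imposed one at a time, each keeping the weights balanced; the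
      -- moment of the empty product is then the count.
      count-matches : ∀ u u′ →
        (∀ ps → All P ps → ∑ xs (λ x → u x ℕ.* ∏ ps (f x)) ≡ ∑ ys (λ y → u′ y ℕ.* ∏ ps (g y))) →
        ∀ cs → All P cs →
        ∑ xs (λ x → u x ℕ.* 𝟙 (matches? f cs x)) ≡ ∑ ys (λ y → u′ y ℕ.* 𝟙 (matches? g cs y))
      count-matches u u′ eq cs pcs = +-injective (trans (out xs u f)
        (trans (balanced-matches cs start pcs .moments [] []) (sym (out ys u′ g))))
        where
        into : ∀ {C : Set} (zs : List C) (w : C → ℕ) (h : C → I → ℕ) ps →
          + ∑ zs (λ x → w x ℕ.* ∏ ps (h x)) ≡ ∑ᶻ zs (λ x → + w x * + ∏ ps (h x))
        into zs w h ps = trans (sym (∑ᶻ-pos zs _)) (∑ᶻ-cong zs (λ x → pos-* (w x) _))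
        start : Balanced (λ x → + u x) (λ y → + u′ y)
        start .moments ps pps = trans (sym (into xs u f ps)) (trans (cong +_ (eq ps pps)) (into ys u′ g ps))
        out : ∀ {C : Set} (zs : List C) (w : C → ℕ) (h : C → I → ℕ) →
          + ∑ zs (λ x → w x ℕ.* 𝟙 (matches? h cs x)) ≡
          ∑ᶻ zs (λ x → + w x * + 𝟙 (matches? h cs x) * + ∏ [] (h x))
        out zs w h = trans (sym (∑ᶻ-pos zs _))
          (∑ᶻ-cong zs (λ x → trans (pos-* (w x) _) (sym (*-identityʳ _))))

open Interpolation

open import Data.Nat using (_+_; _*_; _≤_)
open import Data.Nat.Tactic.RingSolver using (solve-∀)

-- Homomorphism counts as sums of indicators.

∨-true⁻ : ∀ b {c} → b ∨ c ≡ true → b ≡ true ⊎ c ≡ true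
∨-true⁻ true  _ = inj₁ refl
∨-true⁻ false e = inj₂ e

∧-true⁻ : ∀ b {c} → b ∧ c ≡ true → b ≡ true × c ≡ true
∧-true⁻ true e = refl , e

all-true⁻ : ∀ {A : Set} (p : A → Bool) xs → all p xs ≡ true → ∀ {x} → x ∈ xs → p x ≡ true
all-true⁻ p (x ∷ xs) e (here refl) = proj₁ (∧-true⁻ (p x) e)
all-true⁻ p (x ∷ xs) e (there x∈)  = all-true⁻ p xs (proj₂ (∧-true⁻ (p x) e)) x∈

all-true⁺ : ∀ {A : Set} (p : A → Bool) xs → (∀ x → p x ≡ true) → all p xs ≡ true
all-true⁺ p []       h = refl
all-true⁺ p (x ∷ xs) h = cong₂ _∧_ (h x) (all-true⁺ p xs h)

Adj : (X : Graph) → Fin (n X) → Fin (n X) → Set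
Adj X u v = adj X u v ≡ true

Adj? : (X : Graph) → ∀ u v → Dec (Adj X u v)
Adj? X u v = adj X u v B.≟ true

Adj-sym : (X : Graph) → ∀ {u v} → Adj X u v → Adj X v u
Adj-sym X {u} {v} e = trans (adj-sym X v u) e

IsHom : (F X : Graph) → Vec (Fin (n X)) (n F) → Set
IsHom F X f = ∀ i j → Adj F i j → Adj X (lookup f i) (lookup f j)

IsHom? : (F X : Graph) → ∀ f → Dec (IsHom F X f)
IsHom? F X f = F.all? λ i → F.all? λ j → Adj? F i j →-dec Adj? X (lookup f i) (lookup f j)

hom-∑ : (F X : Graph) → hom F X ≡ ∑ (allMaps (n F) (n X)) (λ f → 𝟙 (IsHom? F X f))
hom-∑ F X = ∑-cong (allMaps (n F) (n X)) λ f →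
  trans (if-≟ (isHom F X f)) (𝟙-cong (isHom F X f B.≟ true) (IsHom? F X f) (to f) (from f))
  where
  if-≟ : ∀ b → (if b then 1 else 0) ≡ 𝟙 (b B.≟ true)
  if-≟ true  = refl
  if-≟ false = refl
  to : ∀ f → isHom F X f ≡ true → IsHom F X f
  to f e i j a with ∨-true⁻ (not (adj F i j))
    (all-true⁻ _ (allFin (n F)) (all-true⁻ _ (allFin (n F)) e (∈-allFin i)) (∈-allFin j))
  ... | inj₁ ¬a with () ← trans (sym ¬a) (cong not a)
  ... | inj₂ a′ = a′
  from : ∀ f → IsHom F X f → isHom F X f ≡ true
  from f h = all-true⁺ _ (allFin (n F)) λ i → all-true⁺ _ (allFin (n F)) λ j → go i j (adj F i j) refl
    where
    go : ∀ i j b → adj F i j ≡ b → not b ∨ adj X (lookup f i) (lookup f j) ≡ true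
    go i j true  e = h i j e
    go i j false e = refl

-- Codegrees, twins and twin classes.

module _ (X : Graph) where

  codeg : Fin (n X) → Fin (n X) → ℕ
  codeg u v = ∑ (allFin (n X)) (λ z → 𝟙 (Adj? X u z) * 𝟙 (Adj? X v z))

  codeg-comm : ∀ u v → codeg u v ≡ codeg v u
  codeg-comm u v = ∑-cong (allFin (n X)) λ z → ℕ.*-comm (𝟙 (Adj? X u z)) (𝟙 (Adj? X v z))

  codeg≤n : ∀ u v → codeg u v ≤ n X
  codeg≤n u v = ∑-allFin≤ (n X) _ (λ z → ℕ.*-mono-≤ (𝟙≤1 (Adj? X u z)) (𝟙≤1 (Adj? X v z)))

  Twin : Fin (n X) → Fin (n X) → Set
  Twin u v = ∀ z → adj X u z ≡ adj X v z

  Twin? : ∀ u v → Dec (Twin u v)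
  Twin? u v = F.all? λ z → adj X u z B.≟ adj X v z

  Twin-sym : ∀ {u v} → Twin u v → Twin v u
  Twin-sym t z = sym (t z)

  Twin-trans : ∀ {u v w} → Twin u v → Twin v w → Twin u w
  Twin-trans s t z = trans (s z) (t z)

  Twin-Adj : ∀ {u u′ v v′} → Twin u u′ → Twin v v′ → Adj X u v → Adj X u′ v′
  Twin-Adj {u} {u′} {v} {v′} s t a = Adj-sym X (trans (sym (t u′)) (Adj-sym X (trans (sym (s v)) a)))

  Twin-codeg : ∀ {u u′ v v′} → Twin u u′ → Twin v v′ → codeg u v ≡ codeg u′ v′
  Twin-codeg s t = ∑-cong (allFin (n X)) λ z → cong₂ (λ a b → 𝟙 (a B.≟ true) * 𝟙 (b B.≟ true)) (s z) (t z)

  -- `codeg u u` is the degree of `u`, so equality leaves no neighbour of `u` uncounted in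
  -- `codeg u v`.
  codeg≡deg⇒⊆ : ∀ {u v} → codeg u v ≡ codeg u u → ∀ z → Adj X u z → Adj X v z
  codeg≡deg⇒⊆ {u} {v} e z a = 𝟙-pos (Adj? X v z) (subst (0 ℕ.<_) eq (s≤s z≤n))
    where
    tight : 𝟙 (Adj? X u z) * 𝟙 (Adj? X v z) ≡ 𝟙 (Adj? X u z) * 𝟙 (Adj? X u z)
    tight = ∑-≤-tight (allFin (n X))
      (λ z → subst (𝟙 (Adj? X u z) * 𝟙 (Adj? X v z) ≤_)
                   (trans (ℕ.*-identityʳ _) (sym (𝟙-idem (Adj? X u z))))
                   (ℕ.*-monoʳ-≤ (𝟙 (Adj? X u z)) (𝟙≤1 (Adj? X v z)))) e (∈-allFin z)
    eq : 1 ≡ 𝟙 (Adj? X v z)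
    eq = sym (begin
      𝟙 (Adj? X v z)                      ≡⟨ ℕ.*-identityˡ _ ⟨
      1 * 𝟙 (Adj? X v z)                  ≡⟨ cong (_* 𝟙 (Adj? X v z)) (𝟙-yes (Adj? X u z) a) ⟨
      𝟙 (Adj? X u z) * 𝟙 (Adj? X v z)     ≡⟨ tight ⟩
      𝟙 (Adj? X u z) * 𝟙 (Adj? X u z)     ≡⟨ cong₂ _*_ (𝟙-yes (Adj? X u z) a) (𝟙-yes (Adj? X u z) a) ⟩
      1 ∎)
      where open ≡-Reasoning

  codeg≡deg⇒Twin : ∀ {u v} → codeg u v ≡ codeg u u → codeg u v ≡ codeg v v → Twin u v
  codeg≡deg⇒Twin {u} {v} e e′ z = B.⇔→≡ {z = true}
    (mk⇔ (codeg≡deg⇒⊆ e z) (codeg≡deg⇒⊆ (trans (codeg-comm v u) e′) z))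

  classSize : Fin (n X) → ℕ
  classSize u = ∑ (allFin (n X)) (λ a → 𝟙 (Twin? a u))

  classSize≤n : ∀ u → classSize u ≤ n X
  classSize≤n u = ∑-allFin≤ (n X) _ (λ a → 𝟙≤1 (Twin? a u))

  classSize-cong : ∀ {u v} → Twin u v → classSize u ≡ classSize v
  classSize-cong {u} {v} t = ∑-cong (allFin (n X)) λ a →
    𝟙-cong (Twin? a u) (Twin? a v) (λ s → Twin-trans s t) (λ s → Twin-trans s (Twin-sym t))

-- Attaching gadget vertices, and the effect on homomorphism counts.

eqb⁻ : ∀ {k} {i j : Fin k} → eqb i j ≡ true → i ≡ j
eqb⁻ {i = i} {j} e with i F.≟ j
... | yes p = p

eqb⁺ : ∀ {k} (i : Fin k) → eqb i i ≡ true
eqb⁺ i with i F.≟ i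
... | yes _ = refl
... | no ¬p = ⊥-elim (¬p refl)

-- For equal `a` and `b` the new vertex is pendant, so degrees are covered together with codegrees.
addCommonNeighbour : (F : Graph) → Fin (n F) → Fin (n F) → Graph
addCommonNeighbour F a b = record { n = suc (n F) ; adj = adj′ ; adj-sym = sym′ ; irrefl = irr }
  where
  adj′ : Fin (suc (n F)) → Fin (suc (n F)) → Bool
  adj′ zero    zero    = false
  adj′ zero    (suc j) = eqb j a ∨ eqb j b
  adj′ (suc i) zero    = eqb i a ∨ eqb i b
  adj′ (suc i) (suc j) = adj F i j
  sym′ : ∀ i j → adj′ i j ≡ adj′ j i
  sym′ zero    zero    = refl
  sym′ zero    (suc j) = refl
  sym′ (suc i) zero    = refl
  sym′ (suc i) (suc j) = adj-sym F i j
  irr : ∀ i → adj′ i i ≡ false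
  irr zero    = refl
  irr (suc i) = irrefl F i

-- Once `f` is fixed, the new vertex can go to exactly the common neighbours of the images of `a`
-- and `b`.
∑-addCommonNeighbour : (F X : Graph) (a b : Fin (n F)) (h : Vec (Fin (n X)) (n F) → ℕ) →
  ∑ (allMaps (suc (n F)) (n X)) (λ { (z ∷ᵛ f) → 𝟙 (IsHom? (addCommonNeighbour F a b) X (z ∷ᵛ f)) * h f }) ≡
  ∑ (allMaps (n F) (n X)) (λ f → 𝟙 (IsHom? F X f) * (codeg X (lookup f a) (lookup f b) * h f))
∑-addCommonNeighbour F X a b h = trans (∑-allMaps (n F) (n X) _) (∑-cong (allMaps (n F) (n X)) inner)
  where
  F′ = addCommonNeighbour F a b
  to : ∀ z f → IsHom F′ X (z ∷ᵛ f) → IsHom F X f × Adj X (lookup f a) z × Adj X (lookup f b) z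
  to z f H = (λ i j → H (suc i) (suc j))
    , H (suc a) zero (cong (_∨ eqb a b) (eqb⁺ a))
    , H (suc b) zero (trans (cong (eqb b a ∨_) (eqb⁺ b)) (B.∨-zeroʳ (eqb b a)))
  from : ∀ z f → IsHom F X f → Adj X (lookup f a) z × Adj X (lookup f b) z → IsHom F′ X (z ∷ᵛ f)
  from z f H (p , q) = go
    where
    near : ∀ i → eqb i a ∨ eqb i b ≡ true → Adj X (lookup f i) z
    near i e with ∨-true⁻ (eqb i a) e
    ... | inj₁ e′ rewrite eqb⁻ {i = i} e′ = p
    ... | inj₂ e′ rewrite eqb⁻ {i = i} e′ = q
    go : IsHom F′ X (z ∷ᵛ f)
    go zero    (suc j) e = Adj-sym X (near j e)
    go (suc i) zero    e = near i e
    go (suc i) (suc j) e = H i j e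
  inner : ∀ f → ∑ (allFin (n X)) (λ z → 𝟙 (IsHom? F′ X (z ∷ᵛ f)) * h f) ≡
                𝟙 (IsHom? F X f) * (codeg X (lookup f a) (lookup f b) * h f)
  inner f = begin
    ∑ (allFin (n X)) (λ z → 𝟙 (IsHom? F′ X (z ∷ᵛ f)) * h f)
      ≡⟨ ∑-cong (allFin (n X)) (λ z → trans (cong (_* h f)
          (trans (𝟙-× (IsHom? F X f) (p? z ×-dec q? z) (IsHom? F′ X (z ∷ᵛ f)) (to z f) (from z f))
          (cong (𝟙 (IsHom? F X f) *_) (𝟙-× (p? z) (q? z) (p? z ×-dec q? z) id _,_))))
          (alg (𝟙 (IsHom? F X f)) (𝟙 (p? z) * 𝟙 (q? z)) (h f))) ⟩
    ∑ (allFin (n X)) (λ z → (𝟙 (IsHom? F X f) * h f) * (𝟙 (p? z) * 𝟙 (q? z)))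
      ≡⟨ ∑-*ˡ (allFin (n X)) (𝟙 (IsHom? F X f) * h f) _ ⟩
    (𝟙 (IsHom? F X f) * h f) * codeg X (lookup f a) (lookup f b)
      ≡⟨ alg′ (𝟙 (IsHom? F X f)) (h f) (codeg X (lookup f a) (lookup f b)) ⟩
    𝟙 (IsHom? F X f) * (codeg X (lookup f a) (lookup f b) * h f) ∎
    where
    open ≡-Reasoning
    p? = λ z → Adj? X (lookup f a) z
    q? = λ z → Adj? X (lookup f b) z
    alg : ∀ i d g → i * d * g ≡ i * g * d
    alg = solve-∀
    alg′ : ∀ i g d → i * g * d ≡ i * (d * g)
    alg′ = solve-∀

module Gadget (E : Graph) where

  Pair : Set
  Pair = Fin (n E) × Fin (n E)

  -- Each gadget vertex is attached to vertices of `E`, located by `emb` in the graph built so far;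
  -- gadget vertices are never joined to each other.
  gadget : List Pair → Graph
  emb : ∀ ps → Fin (n E) → Fin (n (gadget ps))

  gadget []             = E
  gadget ((a , b) ∷ ps) = addCommonNeighbour (gadget ps) (emb ps a) (emb ps b)

  emb []       v = v
  emb (_ ∷ ps) v = suc (emb ps v)

  core : ∀ {A : Set} ps → Vec A (n (gadget ps)) → Vec A (n E)
  core []       f        = f
  core (_ ∷ ps) (_ ∷ᵛ f) = core ps f

  lookup-core : ∀ {A : Set} ps (f : Vec A (n (gadget ps))) v → lookup f (emb ps v) ≡ lookup (core ps f) v
  lookup-core []       f        v = refl
  lookup-core (_ ∷ ps) (_ ∷ᵛ f) v = lookup-core ps f v

  weight : (X : Graph) → Vec (Fin (n X)) (n E) → Pair → ℕ
  weight X x (a , b) = codeg X (lookup x a) (lookup x b)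

  -- The factor `h` carries the induction: each gadget vertex that is summed out leaves its codegree
  -- in it.
  ∑-gadget : (X : Graph) → ∀ ps (h : Vec (Fin (n X)) (n E) → ℕ) →
    ∑ (allMaps (n (gadget ps)) (n X)) (λ f → 𝟙 (IsHom? (gadget ps) X f) * h (core ps f)) ≡
    ∑ (allMaps (n E) (n X)) (λ x → 𝟙 (IsHom? E X x) * (∏ ps (weight X x) * h x))
  ∑-gadget X [] h = ∑-cong (allMaps (n E) (n X)) λ x → cong (𝟙 (IsHom? E X x) *_) (sym (ℕ.*-identityˡ (h x)))
  ∑-gadget X ((a , b) ∷ ps) h = begin
    ∑ (allMaps (suc (n (gadget ps))) (n X)) _
      -- `core` reduces only on a vector split into head and tail.
      ≡⟨ ∑-cong (allMaps (suc (n (gadget ps))) (n X)) (λ { (z ∷ᵛ f) → refl }) ⟩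
    ∑ (allMaps (suc (n (gadget ps))) (n X)) _
      ≡⟨ ∑-addCommonNeighbour (gadget ps) X (emb ps a) (emb ps b) (λ f → h (core ps f)) ⟩
    ∑ (allMaps (n (gadget ps)) (n X)) _
      ≡⟨ ∑-cong (allMaps (n (gadget ps)) (n X)) (λ f →
           cong (λ e → 𝟙 (IsHom? (gadget ps) X f) * (e * h (core ps f)))
           (cong₂ (codeg X) (lookup-core ps f a) (lookup-core ps f b))) ⟩
    ∑ (allMaps (n (gadget ps)) (n X)) _
      ≡⟨ ∑-gadget X ps (λ x → weight X x (a , b) * h x) ⟩
    ∑ (allMaps (n E) (n X)) _
      ≡⟨ ∑-cong (allMaps (n E) (n X)) (λ x → cong (𝟙 (IsHom? E X x) *_)
           (alg (∏ ps (weight X x)) (weight X x (a , b)) (h x))) ⟩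
    ∑ (allMaps (n E) (n X)) _ ∎
    where
    open ≡-Reasoning
    alg : ∀ p w h → p * (w * h) ≡ w * p * h
    alg = solve-∀

  hom-gadget : (X : Graph) → ∀ ps →
    hom (gadget ps) X ≡ ∑ (allMaps (n E) (n X)) (λ x → 𝟙 (IsHom? E X x) * ∏ ps (weight X x))
  hom-gadget X ps = trans (hom-∑ (gadget ps) X)
    (trans (∑-cong (allMaps (n (gadget ps)) (n X)) (λ f → sym (ℕ.*-identityʳ _)))
    (trans (∑-gadget X ps (λ _ → 1))
    (∑-cong (allMaps (n E) (n X)) (λ x → cong (𝟙 (IsHom? E X x) *_) (ℕ.*-identityʳ _)))))

-- Topological minors: paths at a branch vertex, and excluding K₅.

injective⇒≤length : ∀ {A : Set} {k} (xs : List A) (f : Fin k → A) →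
  (∀ i j → f i ≡ f j → i ≡ j) → (∀ i → f i ∈ xs) → k ≤ length xs
injective⇒≤length xs f inj f∈ = F.injective⇒≤ {f = λ i → Any.index (f∈ i)} λ {i} {j} e →
  inj i j (trans (lookup-index (f∈ i)) (trans (cong (List.lookup xs) e) (sym (lookup-index (f∈ j)))))

module Branches {M F : Graph} (tm : TopMinor M F) where
  open TopMinor tm

  -- Points of the path between ρ v and ρ w other than ρ v.
  data On (v w : Fin (n M)) (x : Fin (n F)) : Set where
    end : x ≡ ρ w → On v w x
    fwd : ∀ p e → x ∈ interior v w p e → On v w x
    bwd : ∀ p e → x ∈ interior w v p e → On v w x

  -- Interiors are disjoint and avoid branch vertices. In the mixed cases the two paths differ
  -- because `v` is the smaller end of one and the larger end of the other.
  On-disjoint : ∀ {v w w′ x} → On v w x → On v w′ x → w ≡ w′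
  On-disjoint {v} {w} {w′} {x} (end refl) (end e) = ρ-inj w w′ e
  On-disjoint (end refl) (fwd p e i) = ⊥-elim (avoid-ρ _ _ p e _ i)
  On-disjoint (end refl) (bwd p e i) = ⊥-elim (avoid-ρ _ _ p e _ i)
  On-disjoint (fwd p e i) (end refl) = ⊥-elim (avoid-ρ _ _ p e _ i)
  On-disjoint (bwd p e i) (end refl) = ⊥-elim (avoid-ρ _ _ p e _ i)
  On-disjoint {v} {w} {w′} {x} (fwd p e i) (fwd p′ e′ i′) with w F.≟ w′
  ... | yes w≡w′ = w≡w′
  ... | no w≢w′  = ⊥-elim (disjoint _ _ p e _ _ p′ e′ (w≢w′ ∘ proj₂) x i i′)
  On-disjoint {v} {w} {w′} {x} (bwd p e i) (bwd p′ e′ i′) with w F.≟ w′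
  ... | yes w≡w′ = w≡w′
  ... | no w≢w′  = ⊥-elim (disjoint _ _ p e _ _ p′ e′ (w≢w′ ∘ proj₁) x i i′)
  On-disjoint {x = x} (fwd p e i) (bwd p′ e′ i′) =
    ⊥-elim (disjoint _ _ p e _ _ p′ e′ (λ (_ , w≡v) → F.<-irrefl (sym w≡v) p) x i i′)
  On-disjoint {x = x} (bwd p e i) (fwd p′ e′ i′) =
    ⊥-elim (disjoint _ _ p e _ _ p′ e′ (λ (w≡v , _) → F.<-irrefl w≡v p) x i i′)

  first : ∀ {R : Fin (n F) → Fin (n F) → Set} {x z} ys →
          Linked R (x ∷ ys ++ [ z ]) → ∃ λ y → R x y × (y ≡ z ⊎ y ∈ ys)
  first []       (r ∷ _) = _ , r , inj₁ refl
  first (y ∷ ys) (r ∷ _) = _ , r , inj₂ (here refl)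

  last : ∀ {R : Fin (n F) → Fin (n F) → Set} {x z} ys →
         Linked R (x ∷ ys ++ [ z ]) → ∃ λ y → R y z × (y ≡ x ⊎ y ∈ ys)
  last []       (r ∷ _) = _ , r , inj₁ refl
  last (y ∷ ys) (_ ∷ l) with last ys l
  ... | y′ , r , inj₁ refl = y′ , r , inj₂ (here refl)
  ... | y′ , r , inj₂ i    = y′ , r , inj₂ (there i)

  -- Each path is stored in increasing direction only, so its edge at `ρ v` is the first one if `v`
  -- is smaller than `w` and the last one otherwise.
  neighbour : ∀ v w → v ≢ w → Adj M v w → ∃ λ x → Adj F (ρ v) x × On v w x
  neighbour v w v≢w e with F.<-cmp v w
  ... | tri≈ _ v≡w _ = ⊥-elim (v≢w v≡w)
  ... | tri< p _ _ with first (interior v w p e) (is-walk v w p e)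
  ...   | x , r , inj₁ x≡ = x , r , end x≡
  ...   | x , r , inj₂ i  = x , r , fwd p e i
  neighbour v w v≢w e | tri> _ _ p with last (interior w v p (Adj-sym M e)) (is-walk w v p (Adj-sym M e))
  ...   | x , r , inj₁ x≡ = x , Adj-sym F r , end x≡
  ...   | x , r , inj₂ i  = x , Adj-sym F r , bwd p (Adj-sym M e) i

K-adj : ∀ {k} {i j : Fin k} → i ≢ j → Adj (K k) i j
K-adj {i = i} {j} i≢j with i F.≟ j
... | yes i≡j = ⊥-elim (i≢j i≡j)
... | no _    = refl

-- The lists `nb` may exceed the neighbourhoods in `E`: gadget vertices may also be attached to
-- pairs that `nb` joins without an edge of `E`.
module K₅-free (E : Graph) (nb : Fin (n E) → List (Fin (n E)))
  (nb-sym : ∀ {a b} → b ∈ nb a → a ∈ nb b) (nb≤3 : ∀ a → length (nb a) ≤ 3)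
  (E⊆nb : ∀ {a b} → Adj E a b → b ∈ nb a) where
  open Gadget E

  Near : Pair → Set
  Near (a , b) = a ≡ b ⊎ b ∈ nb a

  -- That a gadget vertex lies outside the image of `emb` keeps its two possible neighbours
  -- unchanged when further gadget vertices are attached.
  data View (ps : List Pair) : Fin (n (gadget ps)) → Set where
    isCore   : ∀ a → View ps (emb ps a)
    isGadget : ∀ {u} a b → Near (a , b) → (∀ c → u ≢ emb ps c) →
               (∀ w → Adj (gadget ps) u w → w ≡ emb ps a ⊎ w ≡ emb ps b) → View ps u

  view : ∀ ps → All Near ps → ∀ u → View ps u
  view [] [] u = isCore u
  view ((a , b) ∷ ps) (ab ∷ near) zero = isGadget a b ab (λ _ ()) nbrs
    where
    nbrs : ∀ w → Adj (gadget ((a , b) ∷ ps)) zero w → w ≡ suc (emb ps a) ⊎ w ≡ suc (emb ps b)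
    nbrs (suc w) e with ∨-true⁻ (eqb w (emb ps a)) e
    ... | inj₁ e′ = inj₁ (cong suc (eqb⁻ e′))
    ... | inj₂ e′ = inj₂ (cong suc (eqb⁻ e′))
  view ((a , b) ∷ ps) (ab ∷ near) (suc u) with view ps near u
  ... | isCore c = isCore c
  ... | isGadget c d cd u≢ nbrs = isGadget c d cd (λ a′ e → u≢ a′ (F.suc-injective e)) nbrs′
    where
    nbrs′ : ∀ w → Adj (gadget ((a , b) ∷ ps)) (suc u) w → w ≡ suc (emb ps c) ⊎ w ≡ suc (emb ps d)
    nbrs′ zero e with ∨-true⁻ (eqb u (emb ps a)) e
    ... | inj₁ e′ = ⊥-elim (u≢ a (eqb⁻ e′))
    ... | inj₂ e′ = ⊥-elim (u≢ b (eqb⁻ e′))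
    nbrs′ (suc w) e with nbrs w e
    ... | inj₁ e′ = inj₁ (cong suc e′)
    ... | inj₂ e′ = inj₂ (cong suc e′)

  emb-adj : ∀ ps {a b} → Adj (gadget ps) (emb ps a) (emb ps b) → Adj E a b
  emb-adj []       e = e
  emb-adj (_ ∷ ps) e = emb-adj ps e

  emb-injective : ∀ ps {a b} → emb ps a ≡ emb ps b → a ≡ b
  emb-injective []       e = e
  emb-injective (_ ∷ ps) e = emb-injective ps (F.suc-injective e)

  module _ (ps : List Pair) (near : All Near ps) (tm : TopMinor (K 5) (gadget ps)) where
    open TopMinor tm
    open Branches tm

    -- Gadget vertices have degree at most 2, so every branch vertex lies in the core.
    branch-core : ∀ v → ∃ λ a → ρ v ≡ emb ps a
    branch-core v with ρ v in ρv≡ | view ps near (ρ v)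
    ... | .(emb ps a) | isCore a = a , refl
    ... | u | isGadget a b _ _ nbrs = ⊥-elim (ℕ.<⇒≱ (s≤s (s≤s (s≤s z≤n))) 4≤2)
      where
      -- The four other branch vertices are enumerated by `punchIn v`; their paths would need four
      -- distinct neighbours of `ρ v`.
      other : ∀ i → ∃ λ x → Adj (gadget ps) (ρ v) x × On v (punchIn v i) x
      other i = neighbour v (punchIn v i) (F.punchInᵢ≢i v i ∘ sym) (K-adj (F.punchInᵢ≢i v i ∘ sym))
      4≤2 : 4 ≤ 2
      4≤2 = injective⇒≤length (emb ps a ∷ emb ps b ∷ []) (proj₁ ∘ other)
        (λ i j e → F.punchIn-injective v i j
          (On-disjoint (proj₂ (proj₂ (other i)))
            (subst (On v (punchIn v j)) (sym e) (proj₂ (proj₂ (other j))))))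
        (λ i → cov (nbrs _ (subst (λ u → Adj (gadget ps) u (proj₁ (other i))) ρv≡ (proj₁ (proj₂ (other i))))))
        where
        cov : ∀ {x} → x ≡ emb ps a ⊎ x ≡ emb ps b → x ∈ emb ps a ∷ emb ps b ∷ []
        cov (inj₁ e) = here e
        cov (inj₂ e) = there (here e)

    -- Two core vertices with a common gadget neighbour are near, so the first core vertex
    -- after ρ v on each path out of ρ v comes from the list nb at ρ v.
    next-core : ∀ {v w} → v Fin.< w → Adj (K 5) v w → ∀ {c} → ρ v ≡ emb ps c →
                ∃ λ d → d ∈ nb c × On v w (emb ps d)
    next-core {v} {w} p e {c} ρv≡ = go (interior v w p e) refl (is-walk v w p e) (is-path v w p e)
      where
      G = gadget ps
      adjacent : ∀ {d} → Adj G (ρ v) (emb ps d) → d ∈ nb c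
      adjacent {d} a = E⊆nb (emb-adj ps (subst (λ u → Adj G u (emb ps d)) ρv≡ a))
      -- A gadget vertex `x` after `ρ v` has `ρ v` as one of its two attachments. A path does not
      -- return to `ρ v`, so it continues to the other one.
      through : ∀ {x y a b} → Near (a , b) → (∀ z → Adj G x z → z ≡ emb ps a ⊎ z ≡ emb ps b) →
                Adj G (ρ v) x → Adj G x y → ρ v ≢ y → ∃ λ d → d ∈ nb c × y ≡ emb ps d
      through {x} {y} {a} {b} ab nbrs vx xy v≢y with nbrs (ρ v) (Adj-sym G vx) | nbrs y xy
      ... | inj₁ e₁ | inj₁ e₂ = ⊥-elim (v≢y (trans e₁ (sym e₂)))
      ... | inj₂ e₁ | inj₂ e₂ = ⊥-elim (v≢y (trans e₁ (sym e₂)))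
      ... | inj₁ e₁ | inj₂ e₂ with refl ← emb-injective ps (trans (sym ρv≡) e₁) | ab
      ...   | inj₁ refl = ⊥-elim (v≢y (trans e₁ (sym e₂)))
      ...   | inj₂ b∈   = b , b∈ , e₂
      through {x} {y} {a} {b} ab nbrs vx xy v≢y | inj₂ e₁ | inj₁ e₂
        with refl ← emb-injective ps (trans (sym ρv≡) e₁) | ab
      ...   | inj₁ refl = ⊥-elim (v≢y (trans e₁ (sym e₂)))
      ...   | inj₂ b∈   = a , nb-sym b∈ , e₂
      go : ∀ int → interior v w p e ≡ int →
           Linked (λ a b → adj G a b ≡ true) (ρ v ∷ int ++ [ ρ w ]) →
           Unique (ρ v ∷ int ++ [ ρ w ]) →
           ∃ λ d → d ∈ nb c × On v w (emb ps d)
      go [] _ (a ∷ _) _ with branch-core w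
      ... | d , ρw≡ = d , adjacent (subst (Adj G (ρ v)) ρw≡ a) , end (sym ρw≡)
      go (x ∷ int) int≡ l u with view ps near x
      go (x ∷ int) int≡ (a ∷ _) _ | isCore d =
        d , adjacent a , fwd p e (subst (emb ps d ∈_) (sym int≡) (here refl))
      go (x ∷ []) int≡ (vx ∷ xy ∷ _) ((_ ∷ v≢y ∷ _) ∷ _) | isGadget a b ab _ nbrs
        with through ab nbrs vx xy v≢y
      ... | d , d∈ , y≡ = d , d∈ , end (sym y≡)
      go (x ∷ y ∷ int) int≡ (vx ∷ xy ∷ _) ((_ ∷ v≢y ∷ _) ∷ _) | isGadget a b ab _ nbrs
        with through ab nbrs vx xy v≢y
      ... | d , d∈ , refl = d , d∈ , fwd p e (subst (emb ps d ∈_) (sym int≡) (there (here refl)))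

  -- All four paths at branch vertex `zero` are stored as leaving it. They would reach four distinct
  -- elements of a list of length at most three.
  gadget-K₅-free : ∀ ps → All Near ps → ¬ TopMinor (K 5) (gadget ps)
  gadget-K₅-free ps near tm with branch-core ps near tm zero
  ... | c , ρ0≡ = ℕ.<⇒≱ (s≤s (nb≤3 c))
    (injective⇒≤length (nb c) (proj₁ ∘ next)
      (λ i j e → F.suc-injective (On-disjoint (proj₂ (proj₂ (next i)))
        (subst (λ d → On zero (suc j) (emb ps d)) (sym e) (proj₂ (proj₂ (next j))))))
      (proj₁ ∘ proj₂ ∘ next))
    where
    open Branches tm
    next : (i : Fin 4) → ∃ λ d → d ∈ nb c × On zero (suc i) (emb ps d)
    next i = next-core ps near tm (s≤s z≤n) refl ρ0≡

-- Cores labelled by the vertices of G, and their copies in a graph.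

_∈?_ : ∀ {k} (v : Fin k) (xs : List (Fin k)) → Dec (v ∈ xs)
_∈?_ = DecMembership._∈?_ F._≟_

-- A graph whose vertices are labelled by vertices of G (the map row) and have at most three
-- neighbours each; end r is a vertex of label r at which one more neighbour can be attached.
record Core (G : Graph) : Set where
  field
    N       : ℕ
    row     : Fin N → Fin (n G)
    nb      : Fin N → List (Fin N)
    nb-sym  : ∀ {v w} → w ∈ nb v → v ∈ nb w
    nb≤3    : ∀ v → length (nb v) ≤ 3
    end     : Fin (n G) → Fin N
    row-end : ∀ r → row (end r) ≡ r
    end≤2   : ∀ r → length (nb (end r)) ≤ 2

  ∈?-sym : ∀ v w → does (w ∈? nb v) ≡ does (v ∈? nb w)
  ∈?-sym v w with w ∈? nb v | v ∈? nb w
  ... | yes _ | yes _ = refl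
  ... | no _  | no _  = refl
  ... | yes p | no ¬q = ⊥-elim (¬q (nb-sym p))
  ... | no ¬p | yes q = ⊥-elim (¬p (nb-sym q))

  -- Joined vertices become adjacent only if their rows are adjacent in `G`. The other joined pairs,
  -- such as those within one row, carry just a codegree condition.
  E : Graph
  E = record
    { n       = N
    ; adj     = λ v w → does (w ∈? nb v) ∧ adj G (row v) (row w)
    ; adj-sym = λ v w → cong₂ _∧_ (∈?-sym v w) (adj-sym G (row v) (row w))
    ; irrefl  = λ v → trans (cong (does (v ∈? nb v) ∧_) (irrefl G (row v))) (B.∧-zeroʳ _)
    }

  E⁻ : ∀ {v w} → Adj E v w → w ∈ nb v × Adj G (row v) (row w)
  E⁻ {v} {w} e with w ∈? nb v
  ... | yes w∈ = w∈ , e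

  E⁺ : ∀ {v w} → w ∈ nb v → Adj G (row v) (row w) → Adj E v w
  E⁺ {v} {w} w∈ a = cong₂ _∧_ (dec-true (w ∈? nb v) w∈) a

  Near : Fin N × Fin N → Set
  Near (v , w) = v ≡ w ⊎ w ∈ nb v

  Near? : ∀ p → Dec (Near p)
  Near? (v , w) = (v F.≟ w) ⊎-dec (w ∈? nb v)

  nearPairs : List (Fin N × Fin N)
  nearPairs = filter Near? (cartesianProduct (allFin N) (allFin N))

  nearPairs-near : All Near nearPairs
  nearPairs-near = All.all-filter Near? (cartesianProduct (allFin N) (allFin N))

  rowCodeg : Fin N × Fin N → ℕ
  rowCodeg (v , w) = codeg G (row v) (row w)

  -- Copies of the core in X: x v should behave in X like row v does in G.
  Sat : (X : Graph) → Vec (Fin (n X)) N → Set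
  Sat X x = IsHom E X x ×
    (∀ v w → Near (v , w) → codeg X (lookup x v) (lookup x w) ≡ codeg G (row v) (row w))

open Core

module _ {G : Graph} (C : Core G) (X : Graph) where
  open Gadget (E C) using (weight)

  private
    Matches : Vec (Fin (n X)) (N C) → Set
    Matches x = All (λ p → weight X x p ≡ rowCodeg C p) (nearPairs C)

    matches? : ∀ x → Dec (Matches x)
    matches? x = All.all? (λ p → weight X x p ℕ.≟ rowCodeg C p) (nearPairs C)

    to : ∀ x → IsHom (E C) X x → Matches x → Sat C X x
    to x h m = h , λ v w near →
      All.lookup m (∈-filter⁺ (Near? C) (∈-cartesianProduct⁺ (∈-allFin v) (∈-allFin w)) near)

    from : ∀ x → Sat C X x → IsHom (E C) X x × Matches x
    from x (h , c) = h , All.map (λ {p} → c (proj₁ p) (proj₂ p)) (nearPairs-near C)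

  Sat? : ∀ x → Dec (Sat C X x)
  Sat? x = map′ (uncurry (to x)) (from x) (IsHom? (E C) X x ×-dec matches? x)

  𝟙-Sat : ∀ x → 𝟙 (Sat? x) ≡ 𝟙 (IsHom? (E C) X x) * 𝟙 (matches? x)
  𝟙-Sat x = 𝟙-× (IsHom? (E C) X x) (matches? x) (Sat? x) (from x) (to x)

  -- When both vertices have row `r`, their codegree and both degrees are prescribed to be the
  -- degree of `r`, which is the codegree criterion for twins.
  Sat-row : ∀ x → Sat C X x → ∀ {v w} → w ∈ nb C v → row C v ≡ row C w →
            Twin X (lookup x v) (lookup x w)
  Sat-row x (_ , c) {v} {w} w∈ e = codeg≡deg⇒Twin X
    (trans (c v w (inj₂ w∈)) (trans (cong (codeg G (row C v)) (sym e)) (sym (c v v (inj₁ refl)))))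
    (trans (c v w (inj₂ w∈)) (trans (cong (λ r → codeg G r (row C w)) e) (sym (c w w (inj₁ refl)))))

-- First interpolation: the number of copies of a core is determined.

count : ∀ {G} → Core G → Graph → ℕ
count C X = ∑ (allMaps (N C) (n X)) (λ x → 𝟙 (Sat? C X x))

-- The moments of the codegrees at near pairs are homomorphism counts of K₅-free gadgets, so they
-- agree for `G` and `H`.
count-indist : ∀ {G H} → HomIndist (λ F → ¬ TopMinor (K 5) F) G H → (C : Core G) → count C G ≡ count C H
count-indist {G} {H} indist C =
  trans (∑-cong (allMaps (N C) (n G)) (𝟙-Sat C G))
  (trans (count-matches (rowCodeg C) (λ x → 𝟙 (IsHom? (E C) G x)) (λ x → 𝟙 (IsHom? (E C) H x))
    moments (nearPairs C) (nearPairs-near C))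
  (sym (∑-cong (allMaps (N C) (n H)) (𝟙-Sat C H))))
  where
  open Gadget (E C)
  open K₅-free (E C) (nb C) (nb-sym C) (nb≤3 C) (proj₁ ∘ E⁻ C) using (gadget-K₅-free)
  -- The nodes run up to `n G + n H`, which bounds the codegrees in both graphs.
  open Moments (Near C) (allMaps (N C) (n G)) (allMaps (N C) (n H)) (weight G) (weight H) (suc (n G + n H))
    (λ x (a , b) → s≤s (ℕ.≤-trans (codeg≤n G (lookup x a) (lookup x b)) (ℕ.m≤m+n (n G) (n H))))
    (λ x (a , b) → s≤s (ℕ.≤-trans (codeg≤n H (lookup x a) (lookup x b)) (ℕ.m≤n+m (n H) (n G))))
  moments : ∀ ps → All (Near C) ps →
    ∑ (allMaps (N C) (n G)) (λ x → 𝟙 (IsHom? (E C) G x) * ∏ ps (weight G x)) ≡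
    ∑ (allMaps (N C) (n H)) (λ x → 𝟙 (IsHom? (E C) H x) * ∏ ps (weight H x))
  moments ps near = trans (sym (hom-gadget G ps))
    (trans (indist (gadget ps) (gadget-K₅-free ps near)) (hom-gadget H ps))

-- Lengthening a row by one twin.

module Extend {G : Graph} (C : Core G) (r : Fin (n G)) where

  tip : Fin (N C)
  tip = end C r

  hook : ∀ {v} → Dec (v ≡ tip) → List (Fin (suc (N C)))
  hook (yes _) = [ zero ]
  hook (no _)  = []

  -- The new vertex `zero` hangs on the old end of row `r`, which had room for a third neighbour,
  -- and becomes the new end.
  nb′ : Fin (suc (N C)) → List (Fin (suc (N C)))
  nb′ zero    = [ suc tip ]
  nb′ (suc v) = hook (v F.≟ tip) ++ map suc (nb C v)

  suc∈⁺ : ∀ {v w} → w ∈ nb C v → suc w ∈ nb′ (suc v)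
  suc∈⁺ {v} w∈ = ∈-++⁺ʳ (hook (v F.≟ tip)) (∈-map⁺ suc w∈)

  suc∈⁻ : ∀ {v w} → suc w ∈ nb′ (suc v) → w ∈ nb C v
  suc∈⁻ {v} w∈ with v F.≟ tip
  suc∈⁻ (there w∈) | yes _ with _ , w′∈ , refl ← ∈-map⁻ suc w∈ = w′∈
  suc∈⁻ w∈         | no _  with _ , w′∈ , refl ← ∈-map⁻ suc w∈ = w′∈

  zero∈⁺ : zero ∈ nb′ (suc tip)
  zero∈⁺ with tip F.≟ tip
  ... | yes _ = here refl
  ... | no ¬p = ⊥-elim (¬p refl)

  zero∈⁻ : ∀ {v} → zero ∈ nb′ (suc v) → v ≡ tip
  zero∈⁻ {v} z∈ with v F.≟ tip
  ... | yes p = p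
  ... | no _ with _ , _ , () ← ∈-map⁻ suc z∈

  nb′-sym : ∀ {v w} → w ∈ nb′ v → v ∈ nb′ w
  nb′-sym {zero}  {suc w} (here refl) = zero∈⁺
  nb′-sym {suc v} {zero}  w∈ rewrite zero∈⁻ w∈ = here refl
  nb′-sym {suc v} {suc w} w∈ = suc∈⁺ (nb-sym C (suc∈⁻ w∈))

  length-hook : ∀ {v} (d : Dec (v ≡ tip)) → length (hook d ++ map suc (nb C v)) ≤ 3
  length-hook (yes refl) = s≤s (ℕ.≤-trans (ℕ.≤-reflexive (length-map suc (nb C tip))) (end≤2 C r))
  length-hook {v} (no _) = ℕ.≤-trans (ℕ.≤-reflexive (length-map suc (nb C v))) (nb≤3 C v)

  end′ : ∀ {r′} → Dec (r′ ≡ r) → Fin (suc (N C))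
  end′      (yes _) = zero
  end′ {r′} (no _)  = suc (end C r′)

  row′ : Fin (suc (N C)) → Fin (n G)
  row′ zero    = r
  row′ (suc v) = row C v

  row-end′ : ∀ {r′} (d : Dec (r′ ≡ r)) → row′ (end′ d) ≡ r′
  row-end′ (yes e) = sym e
  row-end′ (no _)  = row-end C _

  end′≤2 : ∀ {r′} (d : Dec (r′ ≡ r)) → length (nb′ (end′ d)) ≤ 2
  end′≤2 (yes _) = s≤s z≤n
  end′≤2 {r′} (no r′≢r) with end C r′ F.≟ tip
  ... | yes e = ⊥-elim (r′≢r (trans (sym (row-end C r′)) (trans (cong (row C) e) (row-end C r))))
  ... | no _  = ℕ.≤-trans (ℕ.≤-reflexive (length-map suc (nb C (end C r′)))) (end≤2 C r′)

  extend : Core G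
  extend = record
    { N       = suc (N C)
    ; row     = row′
    ; nb      = nb′
    ; nb-sym  = nb′-sym
    ; nb≤3    = λ { zero → s≤s z≤n ; (suc v) → length-hook (v F.≟ tip) }
    ; end     = λ r′ → end′ (r′ F.≟ r)
    ; row-end = λ r′ → row-end′ (r′ F.≟ r)
    ; end≤2   = λ r′ → end′≤2 (r′ F.≟ r)
    }

  module _ (X : Graph) (a : Fin (n X)) (x : Vec (Fin (n X)) (N C)) where

    -- The new vertex and the tip are joined and share row `r`, hence are mapped to twins. With the
    -- converse, the extensions of `x` correspond to one twin class.
    Sat-extend⁻ : Sat extend X (a ∷ᵛ x) → Sat C X x × Twin X a (lookup x tip)
    Sat-extend⁻ sat@(h , c) = (h′ , c′) , Sat-row extend X (a ∷ᵛ x) sat {zero} {suc tip} (here refl) (sym (row-end C r))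
      where
      h′ : IsHom (E C) X x
      h′ v w e = h (suc v) (suc w) (E⁺ extend (suc∈⁺ (proj₁ (E⁻ C e))) (proj₂ (E⁻ C e)))
      c′ : ∀ v w → Near C (v , w) → codeg X (lookup x v) (lookup x w) ≡ codeg G (row C v) (row C w)
      c′ v w (inj₁ e)  = c (suc v) (suc w) (inj₁ (cong suc e))
      c′ v w (inj₂ w∈) = c (suc v) (suc w) (inj₂ (suc∈⁺ w∈))

    -- A twin of the image of the tip has the same codegrees, and the new pair imposes no edge
    -- because `G` has no loop at `r`.
    Sat-extend⁺ : Sat C X x → Twin X a (lookup x tip) → Sat extend X (a ∷ᵛ x)
    Sat-extend⁺ (h , c) t = h′ , c′
      where
      tip-codeg : codeg X (lookup x tip) (lookup x tip) ≡ codeg G r r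
      tip-codeg = trans (c tip tip (inj₁ refl)) (cong₂ (codeg G) (row-end C r) (row-end C r))
      same-row : ¬ Adj G r (row C tip)
      same-row e with () ← trans (sym e) (trans (cong (adj G r) (row-end C r)) (irrefl G r))
      h′ : IsHom (E extend) X (a ∷ᵛ x)
      h′ zero zero e with here () ← proj₁ (E⁻ extend {zero} {zero} e)
      h′ zero (suc w) e with here refl ← proj₁ (E⁻ extend {zero} {suc w} e) =
        ⊥-elim (same-row (proj₂ (E⁻ extend {zero} {suc tip} e)))
      h′ (suc v) zero e with refl ← zero∈⁻ (proj₁ (E⁻ extend {suc v} {zero} e)) =
        ⊥-elim (same-row (Adj-sym G (proj₂ (E⁻ extend {suc tip} {zero} e))))
      h′ (suc v) (suc w) e = h v w
        (E⁺ C (suc∈⁻ (proj₁ (E⁻ extend {suc v} {suc w} e))) (proj₂ (E⁻ extend {suc v} {suc w} e)))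
      c′ : ∀ v w → Near extend (v , w) →
           codeg X (lookup (a ∷ᵛ x) v) (lookup (a ∷ᵛ x) w) ≡ codeg G (row′ v) (row′ w)
      c′ zero zero near = trans (Twin-codeg X t t) tip-codeg
      c′ zero (suc w) (inj₂ (here refl)) = trans (Twin-codeg X t (λ _ → refl))
        (trans tip-codeg (cong (codeg G r) (sym (row-end C r))))
      c′ (suc v) zero (inj₂ v∈) with refl ← zero∈⁻ v∈ = trans (Twin-codeg X (λ _ → refl) t)
        (trans tip-codeg (cong (λ s → codeg G s r) (sym (row-end C r))))
      c′ (suc v) (suc w) (inj₁ e)  = c v w (inj₁ (F.suc-injective e))
      c′ (suc v) (suc w) (inj₂ w∈) = c v w (inj₂ (suc∈⁻ w∈))

open Extend using (extend; Sat-extend⁻; Sat-extend⁺)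

-- Second interpolation: prescribing the sizes of twin classes.

module Rows {G : Graph} (C : Core G) where

  extendRows : List (Fin (n G)) → Core G
  extendRows []       = C
  extendRows (r ∷ rs) = extend (extendRows rs) r

  base : ∀ {A : Set} rs → Vec A (N (extendRows rs)) → Vec A (N C)
  base []       x        = x
  base (_ ∷ rs) (_ ∷ᵛ x) = base rs x

  module _ (X : Graph) where

    -- Every extension adds a twin of the previous end, so the class size at the end of a row does
    -- not depend on its length.
    Sat-end : ∀ rs x → Sat (extendRows rs) X x → ∀ r →
              Twin X (lookup x (end (extendRows rs) r)) (lookup (base rs x) (end C r))
    Sat-end []       x        sat r z = refl
    Sat-end (r ∷ rs) (a ∷ᵛ x) sat r′ with r′ F.≟ r | Sat-extend⁻ (extendRows rs) r X a x sat
    ... | yes refl | sat′ , t = Twin-trans X t (Sat-end rs x sat′ r′)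
    ... | no _     | sat′ , _ = Sat-end rs x sat′ r′

    sizes : Vec (Fin (n X)) (N C) → Fin (n G) → ℕ
    sizes x r = classSize X (lookup x (end C r))

    -- Each entry of `rs` contributes the number of choices for its new vertex; `h` accumulates
    -- these factors in the induction.
    ∑-extendRows : ∀ rs (h : Vec (Fin (n X)) (N C) → ℕ) →
      ∑ (allMaps (N (extendRows rs)) (n X)) (λ x → 𝟙 (Sat? (extendRows rs) X x) * h (base rs x)) ≡
      ∑ (allMaps (N C) (n X)) (λ x → 𝟙 (Sat? C X x) * (∏ rs (sizes x) * h x))
    ∑-extendRows [] h = ∑-cong (allMaps (N C) (n X)) λ x →
      cong (𝟙 (Sat? C X x) *_) (sym (ℕ.*-identityˡ (h x)))
    ∑-extendRows (r ∷ rs) h = begin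
      ∑ (allMaps (suc (N D)) (n X)) _
        ≡⟨ ∑-allMaps (N D) (n X) _ ⟩
      ∑ (allMaps (N D) (n X)) (λ x → ∑ (allFin (n X)) (λ a → 𝟙 (Sat? D′ X (a ∷ᵛ x)) * h (base rs x)))
        ≡⟨ ∑-cong (allMaps (N D) (n X)) inner ⟩
      ∑ (allMaps (N D) (n X)) (λ x → 𝟙 (Sat? D X x) * (sizes (base rs x) r * h (base rs x)))
        ≡⟨ ∑-extendRows rs (λ x → sizes x r * h x) ⟩
      ∑ (allMaps (N C) (n X)) _
        ≡⟨ ∑-cong (allMaps (N C) (n X)) (λ x →
             cong (𝟙 (Sat? C X x) *_) (alg (∏ rs (sizes x)) (sizes x r) (h x))) ⟩
      ∑ (allMaps (N C) (n X)) _ ∎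
      where
      open ≡-Reasoning
      D = extendRows rs
      D′ = extendRows (r ∷ rs)
      alg : ∀ p w h → p * (w * h) ≡ w * p * h
      alg = solve-∀
      alg′ : ∀ i d g → i * d * g ≡ i * g * d
      alg′ = solve-∀
      alg″ : ∀ i g d → i * g * d ≡ i * (d * g)
      alg″ = solve-∀
      inner : ∀ x → ∑ (allFin (n X)) (λ a → 𝟙 (Sat? D′ X (a ∷ᵛ x)) * h (base rs x)) ≡
                    𝟙 (Sat? D X x) * (sizes (base rs x) r * h (base rs x))
      inner x = begin
        ∑ (allFin (n X)) (λ a → 𝟙 (Sat? D′ X (a ∷ᵛ x)) * g)
          ≡⟨ ∑-cong (allFin (n X)) (λ a → trans
               (cong (_* g) (𝟙-× (Sat? D X x) (Twin? X a u) (Sat? D′ X (a ∷ᵛ x))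
                 (Sat-extend⁻ D r X a x) (Sat-extend⁺ D r X a x)))
               (alg′ (𝟙 (Sat? D X x)) (𝟙 (Twin? X a u)) g)) ⟩
        ∑ (allFin (n X)) (λ a → 𝟙 (Sat? D X x) * g * 𝟙 (Twin? X a u))
          ≡⟨ ∑-*ˡ (allFin (n X)) (𝟙 (Sat? D X x) * g) _ ⟩
        𝟙 (Sat? D X x) * g * classSize X u
          ≡⟨ alg″ (𝟙 (Sat? D X x)) g (classSize X u) ⟩
        𝟙 (Sat? D X x) * (classSize X u * g)
          -- The present end is known to be a twin of the original one only when `x` is a copy, so
          -- the rewriting takes place under the indicator.
          ≡⟨ 𝟙-*-cong (Sat? D X x) (λ sat → cong (_* g) (classSize-cong X (Sat-end rs x sat r))) ⟩
        𝟙 (Sat? D X x) * (sizes (base rs x) r * g) ∎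
        where
        g = h (base rs x)
        u = lookup x (end D r)

    count-extendRows : ∀ rs → count (extendRows rs) X ≡
      ∑ (allMaps (N C) (n X)) (λ x → 𝟙 (Sat? C X x) * ∏ rs (sizes x))
    count-extendRows rs =
      trans (∑-cong (allMaps (N (extendRows rs)) (n X)) (λ x → sym (ℕ.*-identityʳ (𝟙 (Sat? (extendRows rs) X x)))))
      (trans (∑-extendRows rs (λ _ → 1))
      (∑-cong (allMaps (N C) (n X)) (λ x → cong (𝟙 (Sat? C X x) *_) (ℕ.*-identityʳ (∏ rs (sizes x))))))

  row-Sat : Sat C G (tabulate (row C))
  row-Sat =
      (λ v w e → subst₂ (Adj G) (sym (lookup∘tabulate (row C) v)) (sym (lookup∘tabulate (row C) w))
        (proj₂ (E⁻ C e)))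
    , (λ v w _ → cong₂ (codeg G) (lookup∘tabulate (row C) v) (lookup∘tabulate (row C) w))

  matched? : ∀ X x → Dec (All (λ r → sizes X x r ≡ classSize G r) (allFin (n G)))
  matched? X x = All.all? (λ r → sizes X x r ℕ.≟ classSize G r) (allFin (n G))

  -- Copies whose class sizes are those of `G` are equally many in both graphs, and in `G` the
  -- labelling `row C` is one.
  Sat-transfer : ∀ {H} → HomIndist (λ F → ¬ TopMinor (K 5) F) G H →
    ∃ λ y → Sat C H y × (∀ r → classSize H (lookup y (end C r)) ≡ classSize G r)
  Sat-transfer {H} indist = y
      , 𝟙-pos (Sat? C H y) (pos-*ˡ (𝟙 (Sat? C H y)) (𝟙 (matched? H y)) pos)
      , λ r → All.lookup (𝟙-pos (matched? H y) (pos-*ʳ (𝟙 (Sat? C H y)) (𝟙 (matched? H y)) pos)) (∈-allFin r)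
    where
    pos-*ˡ : ∀ a b → 0 ℕ.< a * b → 0 ℕ.< a
    pos-*ˡ (suc a) b _ = s≤s z≤n
    pos-*ʳ : ∀ a b → 0 ℕ.< a * b → 0 ℕ.< b
    pos-*ʳ a zero    p = ⊥-elim (ℕ.<-irrefl (sym (ℕ.*-zeroʳ a)) p)
    pos-*ʳ a (suc b) _ = s≤s z≤n
    -- Every list of rows is admissible here, because extending keeps the degree bounds of a core.
    open Moments (λ _ → ⊤) (allMaps (N C) (n G)) (allMaps (N C) (n H)) (sizes G) (sizes H) (suc (n G + n H))
      (λ x r → s≤s (ℕ.≤-trans (classSize≤n G (lookup x (end C r))) (ℕ.m≤m+n (n G) (n H))))
      (λ y r → s≤s (ℕ.≤-trans (classSize≤n H (lookup y (end C r))) (ℕ.m≤n+m (n H) (n G))))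
    matched : ∀ X → Vec (Fin (n X)) (N C) → ℕ
    matched X x = 𝟙 (Sat? C X x) * 𝟙 (matched? X x)
    equal : ∑ (allMaps (N C) (n G)) (matched G) ≡ ∑ (allMaps (N C) (n H)) (matched H)
    equal = count-matches (classSize G) (λ x → 𝟙 (Sat? C G x)) (λ y → 𝟙 (Sat? C H y))
      (λ rs _ → trans (sym (count-extendRows G rs))
        (trans (count-indist {G} {H} indist (extendRows rs)) (count-extendRows H rs)))
      (allFin (n G)) (All.tabulate (λ _ → tt))
    x₀ = tabulate (row C)
    sizes₀ : ∀ r → sizes G x₀ r ≡ classSize G r
    sizes₀ r = cong (classSize G) (trans (lookup∘tabulate (row C) (end C r)) (row-end C r))
    positive : 0 ℕ.< ∑ (allMaps (N C) (n H)) (matched H)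
    positive = subst (0 ℕ.<_) equal (∑-pos (allMaps (N C) (n G)) (matched G) (∈-allMaps x₀)
      (ℕ.≤-reflexive (sym (cong₂ _*_ (𝟙-yes (Sat? C G x₀) row-Sat)
        (𝟙-yes (matched? G x₀) (All.tabulate (λ {r} _ → sizes₀ r)))))))
    witness : ∃ λ y → 0 ℕ.< matched H y
    witness = ∑-pos⁻¹ (allMaps (N C) (n H)) (matched H) positive
    y = proj₁ witness
    pos = proj₂ witness

-- The grid: a core in which every two rows meet.

succs : ∀ {k} → Fin (suc k) → List (Fin (suc k))
succs {zero}  zero    = []
succs {suc k} zero    = [ suc zero ]
succs {suc k} (suc j) = map suc (succs j)

succs⁺ : ∀ {k} (j : Fin k) → suc j ∈ succs (inject₁ j)
succs⁺ zero    = here refl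
succs⁺ (suc j) = ∈-map⁺ suc (succs⁺ j)

succs⁻ : ∀ {k} (j : Fin (suc k)) {w} → w ∈ succs j → ∃ λ i → w ≡ suc i × j ≡ inject₁ i
succs⁻ {suc k} zero    (here refl) = zero , refl , refl
succs⁻ {suc k} (suc j) w∈ with ∈-map⁻ suc w∈
... | w , w∈′ , refl with succs⁻ j w∈′
...   | i , refl , refl = suc i , refl , refl

succs≤1 : ∀ {k} (j : Fin (suc k)) → length (succs j) ≤ 1
succs≤1 {zero}  zero    = z≤n
succs≤1 {suc k} zero    = s≤s z≤n
succs≤1 {suc k} (suc j) = ℕ.≤-trans (ℕ.≤-reflexive (length-map suc (succs j))) (succs≤1 j)

-- Cell (i , j) carries vertex i. Each row is a path, and (i , suc j) is also joined to (j , suc i),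
-- so every pair of vertices meets in two joined cells; column 0 is left free for extensions.
module Grid (G : Graph) where

  Cell : Set
  Cell = Fin (n G) × Fin (suc (n G))

  right : Cell → List Cell
  right (i , j) = map (i ,_) (succs j)

  cells : Cell → List Cell
  cells (i , zero)  = right (i , zero)
  -- For equal `i` and `j` the first entry is the cell itself. It gives no edge, as `G` is loopless,
  -- and lets `φ-codeg` treat equal arguments like distinct ones.
  cells (i , suc j) = (j , suc i) ∷ (i , inject₁ j) ∷ right (i , suc j)

  right⊆cells : ∀ i j {q} → q ∈ right (i , j) → q ∈ cells (i , j)
  right⊆cells i zero    q∈ = q∈
  right⊆cells i (suc j) q∈ = there (there q∈)

  right-sym : ∀ i j {q} → q ∈ right (i , j) → (i , j) ∈ cells q
  right-sym i j q∈ with ∈-map⁻ (i ,_) q∈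
  ... | w , w∈ , refl with succs⁻ j w∈
  ...   | j′ , refl , refl = there (here refl)

  cells-sym : ∀ p {q} → q ∈ cells p → p ∈ cells q
  cells-sym (i , zero)  q∈                  = right-sym i zero q∈
  cells-sym (i , suc j) (here refl)         = here refl
  cells-sym (i , suc j) (there (here refl)) = right⊆cells i (inject₁ j) (∈-map⁺ (i ,_) (succs⁺ j))
  cells-sym (i , suc j) (there (there q∈))  = right-sym i (suc j) q∈

  right≤1 : ∀ i j → length (right (i , j)) ≤ 1
  right≤1 i j = ℕ.≤-trans (ℕ.≤-reflexive (length-map (i ,_) (succs j))) (succs≤1 j)

  cells≤3 : ∀ p → length (cells p) ≤ 3
  cells≤3 (i , zero)  = ℕ.≤-trans (right≤1 i zero) (s≤s z≤n)
  cells≤3 (i , suc j) = s≤s (s≤s (right≤1 i (suc j)))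

  code : Cell → Fin (n G * suc (n G))
  code = uncurry combine

  cell : Fin (n G * suc (n G)) → Cell
  cell = remQuot (suc (n G))

  cell-code : ∀ p → cell (code p) ≡ p
  cell-code (i , j) = F.remQuot-combine i j

  code-cell : ∀ v → code (cell v) ≡ v
  code-cell v = F.combine-remQuot {n G} (suc (n G)) v

  code∈ : ∀ p {q} → q ∈ cells p → code q ∈ map code (cells (cell (code p)))
  code∈ p {q} q∈ = ∈-map⁺ code (subst (λ p → q ∈ cells p) (sym (cell-code p)) q∈)

  grid : Core G
  grid = record
    { N       = n G * suc (n G)
    ; row     = proj₁ ∘ cell
    ; nb      = map code ∘ cells ∘ cell
    ; nb-sym  = sym′
    ; nb≤3    = λ v → ℕ.≤-trans (ℕ.≤-reflexive (length-map code (cells (cell v)))) (cells≤3 (cell v))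
    ; end     = λ r → code (r , zero)
    ; row-end = λ r → cong proj₁ (cell-code (r , zero))
    ; end≤2   = λ r → subst (λ p → length (map code (cells p)) ≤ 2) (sym (cell-code (r , zero)))
        (ℕ.≤-trans (ℕ.≤-reflexive (length-map code (right (r , zero)))) (ℕ.≤-trans (right≤1 r zero) (s≤s z≤n)))
    }
    where
    sym′ : ∀ {v w} → w ∈ map code (cells (cell v)) → v ∈ map code (cells (cell w))
    sym′ {v} w∈ with ∈-map⁻ code w∈
    ... | q , q∈ , refl = subst (_∈ map code (cells (cell (code q)))) (code-cell v)
                                (code∈ q (cells-sym (cell v) q∈))

  module _ (H : Graph) (y : Vec (Fin (n H)) (N grid)) (sat : Sat grid H y) where

    at : Cell → Fin (n H)
    at p = lookup y (code p)

    row-code : ∀ p → row grid (code p) ≡ proj₁ p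
    row-code p = cong proj₁ (cell-code p)

    row-twins : ∀ i j → Twin H (at (i , j)) (at (i , zero))
    row-twins i = <-weakInduction _ (λ _ → refl) λ j t →
      Twin-trans H (Sat-row grid H y sat {code (i , suc j)} {code (i , inject₁ j)}
        (code∈ (i , suc j) (there (here refl)))
        (trans (row-code (i , suc j)) (sym (row-code (i , inject₁ j))))) t

    φ : Fin (n G) → Fin (n H)
    φ r = at (r , zero)

    -- The codegree is prescribed at the joined cells `(r , suc s)` and `(s , suc r)`, whose images
    -- are twins of `φ r` and `φ s`.
    φ-codeg : ∀ r s → codeg H (φ r) (φ s) ≡ codeg G r s
    φ-codeg r s = trans (sym (Twin-codeg H (row-twins r (suc s)) (row-twins s (suc r))))
      (trans (proj₂ sat (code (r , suc s)) (code (s , suc r)) (inj₂ (code∈ (r , suc s) (here refl))))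
        (cong₂ (codeg G) (row-code (r , suc s)) (row-code (s , suc r))))

    φ-adj : ∀ r s → Adj G r s → Adj H (φ r) (φ s)
    φ-adj r s a = Twin-Adj H (row-twins r (suc s)) (row-twins s (suc r))
      (proj₁ sat (code (r , suc s)) (code (s , suc r)) (E⁺ grid (code∈ (r , suc s) (here refl))
        (subst₂ (Adj G) (sym (row-code (r , suc s))) (sym (row-code (s , suc r))) a)))

-- Ranks within a subset, and injections between finite sets.

-- For an indicator p, the number of j < i satisfying p.
rank : ∀ {m} → (Fin m → ℕ) → Fin m → ℕ
rank p zero    = 0
rank p (suc i) = p zero + rank (p ∘ suc) i

∑-allFin-suc : ∀ m (f : Fin (suc m) → ℕ) → ∑ (allFin (suc m)) f ≡ f zero + ∑ (allFin m) (f ∘ suc)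
∑-allFin-suc m f = trans (∑-allFin (suc m) f) (cong (f zero +_) (sym (∑-allFin m (f ∘ suc))))

rank<∑ : ∀ {m} (p : Fin m → ℕ) i → p i ≡ 1 → rank p i ℕ.< ∑ (allFin m) p
rank<∑ {suc m} p zero    e = subst (0 ℕ.<_) (sym (∑-allFin-suc m p))
  (ℕ.≤-trans (ℕ.≤-reflexive (sym e)) (ℕ.m≤m+n _ _))
rank<∑ {suc m} p (suc i) e = subst (p zero + rank (p ∘ suc) i ℕ.<_) (sym (∑-allFin-suc m p))
  (ℕ.+-monoʳ-< (p zero) (rank<∑ (p ∘ suc) i e))

rank-injective : ∀ {m} (p : Fin m → ℕ) i j → p i ≡ 1 → p j ≡ 1 → rank p i ≡ rank p j → i ≡ j
rank-injective p zero    zero    ei ej e = refl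
rank-injective p zero    (suc j) ei ej e with () ← trans e (cong (_+ rank (p ∘ suc) j) ei)
rank-injective p (suc i) zero    ei ej e with () ← trans (sym e) (cong (_+ rank (p ∘ suc) i) ej)
rank-injective p (suc i) (suc j) ei ej e = cong suc
  (rank-injective (p ∘ suc) i j ei ej (ℕ.+-cancelˡ-≡ (p zero) _ _ e))

select : ∀ {m} (p : Fin m → ℕ) → (∀ i → p i ≤ 1) →
         ∀ k → k ℕ.< ∑ (allFin m) p → ∃ λ i → p i ≡ 1 × rank p i ≡ k
select {zero}  p p≤1 k ()
select {suc m} p p≤1 k k< = go (p zero) refl k (subst (k ℕ.<_) (∑-allFin-suc m p) k<)
  where
  shift : ∀ {c k} → p zero ≡ c → k ℕ.< ∑ (allFin m) (p ∘ suc) → ∃ λ i → p i ≡ 1 × rank p i ≡ c + k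
  shift {k = k} e k< with select (p ∘ suc) (p≤1 ∘ suc) k k<
  ... | i , pi , ri = suc i , pi , cong₂ _+_ e ri
  go : ∀ c → p zero ≡ c → ∀ k → k ℕ.< p zero + ∑ (allFin m) (p ∘ suc) → ∃ λ i → p i ≡ 1 × rank p i ≡ k
  go 0 e k       k< = shift e (subst (λ c → k ℕ.< c + ∑ (allFin m) (p ∘ suc)) e k<)
  go 1 e zero    _  = zero , e , refl
  go 1 e (suc k) k< = shift e (ℕ.s≤s⁻¹ (subst (λ c → suc k ℕ.< c + ∑ (allFin m) (p ∘ suc)) e k<))
  go (suc (suc _)) e _ _ with s≤s () ← subst (_≤ 1) e (p≤1 zero)

rank-cong : ∀ {m} {p q : Fin m → ℕ} → (∀ i → p i ≡ q i) → ∀ i → rank p i ≡ rank q i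
rank-cong e zero    = refl
rank-cong e (suc i) = cong₂ _+_ (e zero) (rank-cong (e ∘ suc) i)

-- A missed value could be punched out of the codomain, leaving an injection into a set with one
-- element fewer.
injective⇒surjective : ∀ {m k} → m ≡ k → (f : Fin m → Fin k) →
  (∀ i j → f i ≡ f j → i ≡ j) → ∀ y → ∃ λ x → f x ≡ y
injective⇒surjective {zero}  refl f inj ()
injective⇒surjective {suc m} refl f inj y with F.any? (λ x → f x F.≟ y)
... | yes p = p
... | no ¬p = ⊥-elim (ℕ.<-irrefl refl (F.injective⇒≤ {f = λ x → punchOut (y≢ x)}
                (λ {i} {j} e → inj i j (F.punchOut-injective (y≢ i) (y≢ j) e))))
  where
  y≢ : ∀ x → y ≢ f x
  y≢ x e = ¬p (x , sym e)

-- From φ to an isomorphism.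

module Matching (G H : Graph) (n≡ : n G ≡ n H) (φ : Fin (n G) → Fin (n H))
  (φ-codeg : ∀ r s → codeg H (φ r) (φ s) ≡ codeg G r s)
  (φ-adj : ∀ r s → Adj G r s → Adj H (φ r) (φ s))
  (φ-size : ∀ r → classSize H (φ r) ≡ classSize G r) where

  -- Being twins is a condition on codegrees, which `φ` preserves; so different classes of `G` go to
  -- different classes of `H`.
  φ-twin⁻ : ∀ {r s} → Twin H (φ r) (φ s) → Twin G r s
  φ-twin⁻ {r} {s} t = codeg≡deg⇒Twin G
    (trans (sym (φ-codeg r s)) (trans (Twin-codeg H (λ _ → refl) (Twin-sym H t)) (φ-codeg r r)))
    (trans (sym (φ-codeg r s)) (trans (Twin-codeg H t (λ _ → refl)) (φ-codeg s s)))

  twins : (X : Graph) → Fin (n X) → Fin (n X) → ℕ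
  twins X u a = 𝟙 (Twin? X a u)

  twins-cong : (X : Graph) → ∀ {u v} → Twin X u v → ∀ a → twins X u a ≡ twins X v a
  twins-cong X {u} {v} t a = 𝟙-cong (Twin? X a u) (Twin? X a v)
    (λ s → Twin-trans X s t) (λ s → Twin-trans X s (Twin-sym X t))

  twins-self : (X : Graph) → ∀ u → twins X u u ≡ 1
  twins-self X u = 𝟙-yes (Twin? X u u) (λ _ → refl)

  -- The r-th vertex of a twin class of G goes to the r-th vertex of the corresponding class of H.
  choice : ∀ i → ∃ λ h → twins H (φ i) h ≡ 1 × rank (twins H (φ i)) h ≡ rank (twins G i) i
  choice i = select (twins H (φ i)) (λ a → 𝟙≤1 (Twin? H a (φ i))) (rank (twins G i) i)
    (subst (rank (twins G i) i ℕ.<_) (sym (φ-size i)) (rank<∑ (twins G i) i (twins-self G i)))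

  ψ : Fin (n G) → Fin (n H)
  ψ i = proj₁ (choice i)

  ψ-twin : ∀ i → Twin H (ψ i) (φ i)
  ψ-twin i = 𝟙-pos (Twin? H (ψ i) (φ i)) (ℕ.≤-reflexive (sym (proj₁ (proj₂ (choice i)))))

  -- Equal images lie in one class of `H`, so the arguments lie in one class of `G`, where their
  -- ranks agree.
  ψ-injective : ∀ i j → ψ i ≡ ψ j → i ≡ j
  ψ-injective i j e = rank-injective (twins G i) i j (twins-self G i)
    (trans (twins-cong G ij j) (twins-self G j)) same-rank
    where
    φij : Twin H (φ i) (φ j)
    φij = Twin-trans H (Twin-sym H (ψ-twin i)) (subst (λ h → Twin H h (φ j)) (sym e) (ψ-twin j))
    ij : Twin G i j
    ij = φ-twin⁻ φij
    same-rank : rank (twins G i) i ≡ rank (twins G i) j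
    same-rank = begin
      rank (twins G i) i         ≡⟨ proj₂ (proj₂ (choice i)) ⟨
      rank (twins H (φ i)) (ψ i) ≡⟨ cong (rank (twins H (φ i))) e ⟩
      rank (twins H (φ i)) (ψ j) ≡⟨ rank-cong (twins-cong H φij) (ψ j) ⟩
      rank (twins H (φ j)) (ψ j) ≡⟨ proj₂ (proj₂ (choice j)) ⟩
      rank (twins G j) j         ≡⟨ rank-cong (twins-cong G ij) j ⟨
      rank (twins G i) j         ∎
      where open ≡-Reasoning

  ψ-surjective : ∀ y → ∃ λ x → ψ x ≡ y
  ψ-surjective = injective⇒surjective n≡ ψ ψ-injective

  bijection : Fin (n G) ↔ Fin (n H)
  bijection = mk↔ₛ′ ψ (proj₁ ∘ ψ-surjective) (proj₂ ∘ ψ-surjective)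
    (λ x → ψ-injective _ x (proj₂ (ψ-surjective (ψ x))))

  ψ-adj : ∀ i j → Adj G i j → Adj H (ψ i) (ψ j)
  ψ-adj i j a = Twin-Adj H (Twin-sym H (ψ-twin i)) (Twin-sym H (ψ-twin j)) (φ-adj i j a)

  ψ-codeg : ∀ i → codeg H (ψ i) (ψ i) ≡ codeg G i i
  ψ-codeg i = trans (Twin-codeg H (ψ-twin i) (ψ-twin i)) (φ-codeg i i)

  -- ψ maps neighbourhoods injectively into neighbourhoods of the same size.
  ψ-adj⁻ : ∀ i j → Adj H (ψ i) (ψ j) → Adj G i j
  ψ-adj⁻ i j a = 𝟙-pos (Adj? G i j)
    (subst (0 ℕ.<_) (sym tight) (ℕ.≤-reflexive (sym (𝟙-yes (Adj? H (ψ i) (ψ j)) a))))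
    where
    deg : (X : Graph) → ∀ u → codeg X u u ≡ ∑ (allFin (n X)) (λ z → 𝟙 (Adj? X u z))
    deg X u = ∑-cong (allFin (n X)) λ z → 𝟙-idem (Adj? X u z)
    tight : 𝟙 (Adj? G i j) ≡ 𝟙 (Adj? H (ψ i) (ψ j))
    tight = ∑-≤-tight (allFin (n G)) (λ j → 𝟙-mono (Adj? G i j) (Adj? H (ψ i) (ψ j)) (ψ-adj i j))
      (trans (sym (deg G i)) (trans (sym (ψ-codeg i)) (trans (deg H (ψ i))
        (∑-reindex bijection (λ z → 𝟙 (Adj? H (ψ i) z)))))) (∈-allFin j)

  iso : Iso G H
  iso = bijection , λ i j → B.⇔→≡ {z = true} (mk⇔ (ψ-adj i j) (ψ-adj⁻ i j))

-- Equal vertex numbers, invariance of counts, and the theorem.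

indist⇒n≡ : ∀ G H → HomIndist (λ F → ¬ TopMinor (K 5) F) G H → n G ≡ n H
indist⇒n≡ G H indist = trans (sym (hom-K₁ G)) (trans (indist (K 1) free) (hom-K₁ H))
  where
  unique : (a b : Fin 1) → a ≡ b
  unique zero zero = refl
  -- `K 1` cannot hold two distinct branch vertices.
  free : ¬ TopMinor (K 5) (K 1)
  free tm with () ← TopMinor.ρ-inj tm zero (suc zero) (unique _ _)
  hom-K₁ : ∀ X → hom (K 1) X ≡ n X
  hom-K₁ X = trans (∑-allMaps 0 (n X) (λ f → if isHom (K 1) X f then 1 else 0))
    (trans (ℕ.+-identityʳ _) (∑-const-1 (n X)))

∑-allMaps-reindex : ∀ {m m′} (π : Fin m ↔ Fin m′) k (f : Vec (Fin m′) k → ℕ) →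
  ∑ (allMaps k m′) f ≡ ∑ (allMaps k m) (f ∘ mapᵛ (Inverse.to π))
∑-allMaps-reindex π zero    f = refl
∑-allMaps-reindex {m} {m′} π (suc k) f = begin
  ∑ (allMaps (suc k) m′) f
    ≡⟨ ∑-allMaps k m′ f ⟩
  ∑ (allMaps k m′) (λ x → ∑ (allFin m′) (λ a → f (a ∷ᵛ x)))
    ≡⟨ ∑-cong (allMaps k m′) (λ x → ∑-reindex π (λ a → f (a ∷ᵛ x))) ⟩
  ∑ (allMaps k m′) (λ x → ∑ (allFin m) (λ a → f (Inverse.to π a ∷ᵛ x)))
    ≡⟨ ∑-allMaps-reindex π k _ ⟩
  ∑ (allMaps k m) (λ x → ∑ (allFin m) (λ a → f (Inverse.to π a ∷ᵛ mapᵛ (Inverse.to π) x)))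
    ≡⟨ ∑-allMaps k m (f ∘ mapᵛ (Inverse.to π)) ⟨
  ∑ (allMaps (suc k) m) (f ∘ mapᵛ (Inverse.to π)) ∎
  where open ≡-Reasoning

iso⇒hom≡ : ∀ G H → Iso G H → ∀ F → hom F G ≡ hom F H
iso⇒hom≡ G H (π , π-adj) F = trans (hom-∑ F G) (trans
  (∑-cong (allMaps (n F) (n G)) (λ f → 𝟙-cong (IsHom? F G f) (IsHom? F H (mapᵛ to f))
    (λ h i j a → trans (sym (adj-map f i j)) (h i j a)) (λ h i j a → trans (adj-map f i j) (h i j a))))
  (trans (sym (∑-allMaps-reindex π (n F) (λ f → 𝟙 (IsHom? F H f)))) (sym (hom-∑ F H))))
  where
  to = Inverse.to π
  adj-map : ∀ f i j → adj G (lookup f i) (lookup f j) ≡ adj H (lookup (mapᵛ to f) i) (lookup (mapᵛ to f) j)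
  adj-map f i j = trans (π-adj _ _) (sym (cong₂ (adj H) (lookup-map i to f) (lookup-map j to f)))

indist⇒iso : ∀ G H → HomIndist (λ F → ¬ TopMinor (K 5) F) G H → Iso G H
indist⇒iso G H indist = transferred (Rows.Sat-transfer grid {H} indist)
  where
  open Grid G
  transferred : (∃ λ y → Sat grid H y × (∀ r → classSize H (lookup y (end grid r)) ≡ classSize G r)) →
                Iso G H
  transferred (y , sat , sizes) = Matching.iso G H (indist⇒n≡ G H indist)
    (φ H y sat) (φ-codeg H y sat) (φ-adj H y sat) sizes

theorem1p3 : (G H : Graph) → Iso G H ⇔ HomIndist (λ F → ¬ TopMinor (K 5) F) G H
theorem1p3 G H = mk⇔ (λ iso F _ → iso⇒hom≡ G H iso F) (indist⇒iso G H)
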